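{- (a) For all integers $n,r$ with $n-1\geq r\geq1$, $$J_n^{(r)}(q)=\sum [r]_q^{\,u_1}[u_1]_q^{\,u_2}\cdots[u_{k-1}]_q^{\,u_k}\,q^{n(u')}\binom{n-r}{u_1,u_2,\dots,u_k},$$ where the sum is over all $k\geq1$ and all $k$-tuples $u=(u_1,\dots,u_k)$ of strictly positive integers with $u_1+\dots+u_k=n-r$, $n(u')=\sum_{i=1}^k\binom{u_i}{2}$, and $\binom{n-r}{u_1,\dots,u_k}$ is the multinomial coefficient. (b) For all integers $n\geq r\geq0$, $$J_n^{(r)}(q)=(n-r)!\sum [r]_q^{\,u_1}\,q^{n(u')}\prod_{i\geq1}\frac{[u_i]_q^{\,u_{i+1}}}{u_i!},$$ where the sum is over all sequences $u=(u_i)_{i\geq1}$ of nonnegative integers, only finitely many nonzero, with $\sum_{i\geq1}u_i=n-r$, and $n(u')=\sum_{i\geq1}\binom{u_i}{2}$.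
   Context: Let $\Lambda$ be the ring of symmetric functions in infinitely many variables with coefficients in $\mathbb{Q}(q)$; $e_n$ are the elementary symmetric functions and $m_\lambda$ the monomial symmetric functions. For $n\geq r\geq1$, $p_n^{(r)}=\sum m_\lambda$ over all partitions $\lambda$ of $n$ with exactly $r$ parts. Let $\varphi:\Lambda\to\mathbb{Q}(q)$ be the $\mathbb{Q}(q)$-algebra homomorphism with $\varphi(e_n)=q^{\binom n2}/n!$ for $n\geq1$. For $n\geq r\geq1$ define $J_n^{(r)}(q)$ by $\varphi(p_n^{(r)})=(1-q)^{n-r}\frac{q^{\binom r2}}{r!\,(n-r)!}J_n^{(r)}(q)$, and set $J_n^{(0)}=\delta_{n,0}$ for $n\geq0$. Here $[k]_q=1+q+\dots+q^{k-1}$ for $k\geq1$, $[0]_q=0$, with $[0]_q^0=1$ and $0!=1$. -}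

module Defs where

open import Data.Bool using (Bool; true; false; _∧_; if_then_else_)
open import Data.Nat as ℕ using (ℕ; zero; suc; _∸_; _!; _≡ᵇ_)
open import Data.Nat.Properties using (_!≢0)
open import Data.Nat.Combinatorics using (_C_)
open import Data.Integer using (+_)
open import Data.Rational as ℚ using (ℚ; 0ℚ; 1ℚ; _+_; _*_; -_)
open import Data.List using (List; []; _∷_; map; foldr; concatMap; upTo; filterᵇ; replicate; _++_; length)
open import Data.Product using (_×_; _,_)
open import Relation.Binary.PropositionalEquality using (_≡_)

-- Polynomials in q with rational coefficients: ℚ[q] ⊆ ℚ(q).
-- A polynomial is its coefficient list (index i = coefficient of q^i);
-- equality ignores trailing zeros.

Poly : Set
Poly = List ℚ

coeff : Poly → ℕ → ℚ
coeff []      _       = 0ℚ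
coeff (a ∷ p) zero    = a
coeff (a ∷ p) (suc i) = coeff p i

infix 4 _≈ₚ_
_≈ₚ_ : Poly → Poly → Set
p ≈ₚ p' = ∀ i → coeff p i ≡ coeff p' i

infixl 6 _⊕_
_⊕_ : Poly → Poly → Poly
[]      ⊕ p'       = p'
(a ∷ p) ⊕ []       = a ∷ p
(a ∷ p) ⊕ (b ∷ p') = (a + b) ∷ (p ⊕ p')

scale : ℚ → Poly → Poly
scale c p = map (c *_) p

infixl 7 _⊗_
_⊗_ : Poly → Poly → Poly
[]      ⊗ p' = []
(a ∷ p) ⊗ p' = scale a p' ⊕ (0ℚ ∷ (p ⊗ p'))

oneP : Poly
oneP = 1ℚ ∷ []

-- p ^ k, with p ^ 0 = 1 (so [0]_q ^ 0 = 1)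
powP : Poly → ℕ → Poly
powP p zero    = oneP
powP p (suc k) = p ⊗ powP p k

sumP : List Poly → Poly
sumP = foldr _⊕_ []

prodP : List Poly → Poly
prodP = foldr _⊗_ oneP

qpow : ℕ → Poly
qpow k = replicate k 0ℚ ++ (1ℚ ∷ [])

qint : ℕ → Poly
qint k = replicate k 1ℚ

oneMinusQ : Poly
oneMinusQ = 1ℚ ∷ (- 1ℚ) ∷ []

fromℕ : ℕ → ℚ
fromℕ n = + n ℚ./ 1

invFact : ℕ → ℚ
invFact k = (+ 1 ℚ./ (k !)) {{k !≢0}}

-- Symmetric functions, via monomial coefficients.
-- A monomial x_1^{a_1} ... x_N^{a_N} (in finitely many of the variables)
-- is given by its exponent list a = (a_1,...,a_N); every N is allowed.

-- all ways of lowering by one exactly k positive entries of a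
-- (i.e. dividing x^a by a squarefree monomial x_{i_1}...x_{i_k}, i_1<...<i_k)
choose : ℕ → List ℕ → List (List ℕ)
choose zero    a       = a ∷ []
choose (suc k) []      = []
choose (suc k) (x ∷ a) =
  map (x ∷_) (choose (suc k) a) ++ lower x
  where
  lower : ℕ → List (List ℕ)
  lower zero     = []
  lower (suc x') = map (x' ∷_) (choose k a)

isZero : ℕ → Bool
isZero n = n ≡ᵇ 0

all : (ℕ → Bool) → List ℕ → Bool
all p = foldr (λ x b → p x ∧ b) true

-- coefficient of x^a in e_μ = e_{μ_1} e_{μ_2} ... (with e_0 = 1),
-- where e_k = Σ_{i_1<...<i_k} x_{i_1}...x_{i_k}
eCoeff : List ℕ → List ℕ → ℕ
eCoeff []      a = if all isZero a then 1 else 0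
eCoeff (k ∷ μ) a = foldr ℕ._+_ 0 (map (eCoeff μ) (choose k a))

sumℕ : List ℕ → ℕ
sumℕ = foldr ℕ._+_ 0

nonzeros : List ℕ → ℕ
nonzeros a = length (filterᵇ (λ x → if isZero x then false else true) a)

-- coefficient of x^a in p_n^{(r)} = Σ_{λ ⊢ n, ℓ(λ)=r} m_λ :
-- 1 if x^a has degree n and involves exactly r variables, else 0
pCoeff : ℕ → ℕ → List ℕ → ℕ
pCoeff n r a = if (sumℕ a ≡ᵇ n) ∧ (nonzeros a ≡ᵇ r) then 1 else 0

-- An expression Σ_j c_j e_{μ^(j)} (c_j ∈ ℚ, μ^(j) finite lists)
EExpr : Set
EExpr = List (ℚ × List ℕ)

Represents : ℕ → ℕ → EExpr → Set
Represents n r rep =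
  ∀ (a : List ℕ) →
    foldr _+_ 0ℚ (map (λ { (c , μ) → c * fromℕ (eCoeff μ a) }) rep)
      ≡ fromℕ (pCoeff n r a)

φe : ℕ → Poly
φe k = scale (invFact k) (qpow (k C 2))

φ : EExpr → Poly
φ rep = sumP (map (λ { (c , μ) → scale c (prodP (map φe μ)) }) rep)

-- "J_n^{(r)}(q) = P":
--   r = 0 : J_n^{(0)} = δ_{n,0};
--   r ≥ 1 : φ(p_n^{(r)}) = (1-q)^{n-r} q^{C(r,2)} / (r! (n-r)!) · P,
--           with φ(p_n^{(r)}) computed from any e-expansion of p_n^{(r)}.
JIs : ℕ → ℕ → Poly → Set
JIs n zero    P = P ≈ₚ (if n ≡ᵇ 0 then oneP else [])
JIs n (suc r) P =
  ∀ (rep : EExpr) → Represents n (suc r) rep →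
    φ rep ≈ₚ scale (invFact (suc r) * invFact (n ∸ suc r))
                   (powP oneMinusQ (n ∸ suc r) ⊗ qpow (suc r C 2) ⊗ P)

boxLists : ℕ → ℕ → List (List ℕ)
boxLists zero    B = [] ∷ []
boxLists (suc L) B = concatMap (λ x → map (x ∷_) (boxLists L B)) (upTo (suc B))

compositions : ℕ → List (List ℕ)
compositions m =
  concatMap (λ k → filterᵇ (λ u → (sumℕ u ≡ᵇ m) ∧ all (λ x → if isZero x then false else true) u)
                           (boxLists k m))
            (map suc (upTo m))

nprime : List ℕ → ℕ
nprime u = sumℕ (map (_C 2) u)

multinom : ℕ → List ℕ → ℚ
multinom m u = fromℕ (m !) * foldr _*_ 1ℚ (map invFact u)

chainA : ℕ → List ℕ → Poly
chainA prev []      = oneP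
chainA prev (x ∷ u) = powP (qint prev) x ⊗ chainA x u

formulaA : ℕ → ℕ → Poly
formulaA n r =
  sumP (map (λ u → scale (multinom (n ∸ r) u) (chainA r u ⊗ qpow (nprime u)))
            (compositions (n ∸ r)))

headOr0 : List ℕ → ℕ
headOr0 []      = 0
headOr0 (x ∷ _) = x

-- Π_{i≥1} [u_i]^{u_{i+1}} / u_i!  for the sequence u_1,...,u_L,0,0,...
prodB : List ℕ → Poly
prodB []      = oneP
prodB (x ∷ u) = scale (invFact x) (powP (qint x) (headOr0 u)) ⊗ prodB u

-- (n-r)! Σ_u [r]^{u_1} q^{n(u')} Π_i [u_i]^{u_{i+1}}/u_i!,
-- u ranging over sequences supported in positions 1..L with Σ u_i = n-r
formulaB : ℕ → ℕ → ℕ → Poly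
formulaB n r L =
  scale (fromℕ ((n ∸ r) !))
    (sumP (map (λ u → powP (qint r) (headOr0 u) ⊗ qpow (nprime u) ⊗ prodB u)
               (filterᵇ (λ u → sumℕ u ≡ᵇ (n ∸ r)) (boxLists L (n ∸ r)))))

{-# OPTIONS --safe #-}
module Submission where

-- Put E(t) = ∑ₙ φ(eₙ) tⁿ and Pᵣ(t) = ∑ₙ p_n^{(r)} tⁿ. Applying φ to the identity
-- E(-t) ∑ᵣ Pᵣ(t) yʳ = E((y-1)t) and using E'(t) = E(qt), Taylor's formula gives
-- φ(Pᵣ(t)) = q^{C(r,2)} (tʳ/r!) E(-qʳt)/E(-t), so up to normalisation the J_{r+m}^{(r)} are the
-- coefficients of E(-qʳt)/E(-t). Splitting off the first entry u₁ of a sequence turns both sums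
-- into a recursion, which Taylor's formula around -t shows to be satisfied by E(-qʳt)/E(-t).
-- That φ(p_n^{(r)}) does not depend on the chosen e-expansion is the algebraic independence of
-- the e_k.

open import Defs
open import Algebra.Bundles using (CommutativeRing)
open import Algebra.Morphism.Structures using (module RingMorphisms)
import Algebra.Properties.Semiring.Exp as Exp
open import Data.Bool as Bool using (Bool; true; false; _∧_; if_then_else_)
import Data.Bool.Properties as Bool
import Data.Integer as ℤ
import Data.Integer.Properties as ℤ
open import Data.List using (List; []; _∷_; map; foldr; concatMap; upTo; applyUpTo; filterᵇ; _++_; length; replicate)
open import Data.List.Properties
  using (map-++; map-∘; map-applyUpTo; filter-++; length-map; length-replicate; ++-identityʳ)
open import Data.List.Relation.Binary.Permutation.Propositional as Perm using (_↭_)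
open import Data.List.Relation.Binary.Permutation.Propositional.Properties using (All-resp-↭; ↭-length)
open import Data.List.Relation.Unary.All as All using (All; []; _∷_)
open import Data.Nat as ℕ using (ℕ; zero; suc; z≤n; s≤s; _≤_; _<_; _∸_; _!; _≡ᵇ_)
open import Data.Nat.Combinatorics using (_C_; nC1≡n; nCk+nC[k+1]≡[n+1]C[k+1])
import Data.Nat.Properties as ℕ
open import Data.Product using (_×_; _,_; proj₁; proj₂; ∃; ∃₂)
open import Data.Rational as ℚ using (ℚ; 0ℚ; 1ℚ)
import Data.Rational.Properties as ℚ
open import Data.Rational.Unnormalised as ℚᵘ using (mkℚᵘ; *≡*)
import Data.Rational.Unnormalised.Properties as ℚᵘ
open import Data.Sum using (_⊎_; inj₁; inj₂)
open import Function using (_∘_)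
open import Level using (0ℓ)
open import Relation.Binary.Bundles using (Setoid)
open import Relation.Binary.PropositionalEquality as ≡ using (_≡_; refl; cong; cong₂; subst)

-- No power series is formed. Every identity concerns the coefficient of a single power of t, and
-- dividing by E(-t) becomes a recursion, possible because E has constant term 1. Sequences are cut
-- off after L positions. As [0]_q^u = 0 for u > 0, a sequence with a nonzero term is a composition
-- followed by zeros, so L ≥ n-r positions lose nothing; the same remark turns the sum in (b) into
-- the sum in (a). It also carries the induction on L: an entry 0 ends the recursion at once, and
-- any other entry lowers the sum that is left for the remaining L-1 positions. On coefficients,
-- Taylor's formula is the rule for C(u+w,2) combined with the binomial theorem. The factor
-- (1-q)^{n-r} in the definition of J is there because (1-q)[r]_q = 1-q^r, and (1-q^r)t is the
-- increment leading from -t to -q^r t. The definition of J tests every e-expansion of p_n^{(r)}.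
-- One expansion, `pExpr`, is therefore built by the very recursion that φ can follow, and any other
-- is compared with it.

module Arithmetic where

  -- Factorials in ℚ and binomial coefficients.

  open import Data.Integer using (+_)

  toℚᵘ-fromℕ : ∀ n → ℚ.toℚᵘ (fromℕ n) ℚᵘ.≃ mkℚᵘ (+ n) 0
  toℚᵘ-fromℕ n = ℚ.toℚᵘ-fromℚᵘ (mkℚᵘ (+ n) 0)

  fromℕ-suc : ∀ n → fromℕ (suc n) ≡ 1ℚ ℚ.+ fromℕ n
  fromℕ-suc n = ℚ.toℚᵘ-injective (begin
    ℚ.toℚᵘ (fromℕ (suc n))            ≈⟨ toℚᵘ-fromℕ (suc n) ⟩
    mkℚᵘ (+ suc n) 0                  ≈⟨ *≡* (cong (λ z → (+ 1 ℤ.+ z) ℤ.* + 1) (≡.sym (ℤ.*-identityʳ (+ n)))) ⟩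
    mkℚᵘ (+ 1) 0 ℚᵘ.+ mkℚᵘ (+ n) 0    ≈⟨ ℚᵘ.+-cong (ℚᵘ.≃-refl {mkℚᵘ (+ 1) 0}) (ℚᵘ.≃-sym (toℚᵘ-fromℕ n)) ⟩
    ℚ.toℚᵘ 1ℚ ℚᵘ.+ ℚ.toℚᵘ (fromℕ n)   ≈⟨ ℚᵘ.≃-sym (ℚ.toℚᵘ-homo-+ 1ℚ (fromℕ n)) ⟩
    ℚ.toℚᵘ (1ℚ ℚ.+ fromℕ n)           ∎)
    where open import Relation.Binary.Reasoning.Setoid ℚᵘ.≃-setoid

  fromℕ-+ : ∀ m n → fromℕ (m ℕ.+ n) ≡ fromℕ m ℚ.+ fromℕ n
  fromℕ-+ zero    n = ≡.sym (ℚ.+-identityˡ (fromℕ n))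
  fromℕ-+ (suc m) n = begin
    fromℕ (suc (m ℕ.+ n))              ≡⟨ fromℕ-suc (m ℕ.+ n) ⟩
    1ℚ ℚ.+ fromℕ (m ℕ.+ n)             ≡⟨ cong (1ℚ ℚ.+_) (fromℕ-+ m n) ⟩
    1ℚ ℚ.+ (fromℕ m ℚ.+ fromℕ n)       ≡⟨ ℚ.+-assoc 1ℚ (fromℕ m) (fromℕ n) ⟨
    1ℚ ℚ.+ fromℕ m ℚ.+ fromℕ n         ≡⟨ cong (ℚ._+ fromℕ n) (fromℕ-suc m) ⟨
    fromℕ (suc m) ℚ.+ fromℕ n          ∎
    where open ≡.≡-Reasoning

  fromℕ-* : ∀ m n → fromℕ (m ℕ.* n) ≡ fromℕ m ℚ.* fromℕ n
  fromℕ-* zero    n = ≡.sym (ℚ.*-zeroˡ (fromℕ n))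
  fromℕ-* (suc m) n = begin
    fromℕ (n ℕ.+ m ℕ.* n)                    ≡⟨ fromℕ-+ n (m ℕ.* n) ⟩
    fromℕ n ℚ.+ fromℕ (m ℕ.* n)              ≡⟨ cong₂ ℚ._+_ (≡.sym (ℚ.*-identityˡ (fromℕ n))) (fromℕ-* m n) ⟩
    1ℚ ℚ.* fromℕ n ℚ.+ fromℕ m ℚ.* fromℕ n   ≡⟨ ℚ.*-distribʳ-+ (fromℕ n) 1ℚ (fromℕ m) ⟨
    (1ℚ ℚ.+ fromℕ m) ℚ.* fromℕ n             ≡⟨ cong (ℚ._* fromℕ n) (fromℕ-suc m) ⟨
    fromℕ (suc m) ℚ.* fromℕ n                ∎
    where open ≡.≡-Reasoning

  fromℕ*1/ : ∀ d .{{_ : ℕ.NonZero d}} → fromℕ d ℚ.* (+ 1 ℚ./ d) ≡ 1ℚ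
  fromℕ*1/ (suc d) = ℚ.toℚᵘ-injective (begin
    ℚ.toℚᵘ (fromℕ (suc d) ℚ.* (+ 1 ℚ./ suc d))           ≈⟨ ℚ.toℚᵘ-homo-* (fromℕ (suc d)) (+ 1 ℚ./ suc d) ⟩
    ℚ.toℚᵘ (fromℕ (suc d)) ℚᵘ.* ℚ.toℚᵘ (+ 1 ℚ./ suc d)   ≈⟨ ℚᵘ.*-cong (toℚᵘ-fromℕ (suc d)) (ℚ.toℚᵘ-fromℚᵘ (mkℚᵘ (+ 1) d)) ⟩
    mkℚᵘ (+ suc d) 0 ℚᵘ.* mkℚᵘ (+ 1) d                   ≈⟨ *≡* (cong (λ z → + suc z) (≡.trans (cong (ℕ._* 1) (ℕ.*-identityʳ d)) (≡.trans (ℕ.*-identityʳ d)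
                                                             (≡.sym (≡.trans (ℕ.+-identityʳ (d ℕ.+ 0)) (ℕ.+-identityʳ d)))))) ⟩
    ℚ.toℚᵘ 1ℚ                                            ∎)
    where open import Relation.Binary.Reasoning.Setoid ℚᵘ.≃-setoid

  fromℕ!*invFact : ∀ n → fromℕ (n !) ℚ.* invFact n ≡ 1ℚ
  fromℕ!*invFact n = fromℕ*1/ (n !) {{n ℕ.!≢0}}

  fromℕ-suc*invFact-suc : ∀ n → fromℕ (suc n) ℚ.* invFact (suc n) ≡ invFact n
  fromℕ-suc*invFact-suc n = begin
    s ℚ.* i′                           ≡⟨ ℚ.*-identityʳ _ ⟨
    s ℚ.* i′ ℚ.* 1ℚ                    ≡⟨ cong (s ℚ.* i′ ℚ.*_) (fromℕ!*invFact n) ⟨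
    s ℚ.* i′ ℚ.* (f ℚ.* i)             ≡⟨ lemma s i′ f i ⟩
    s ℚ.* f ℚ.* i′ ℚ.* i               ≡⟨ cong (λ z → z ℚ.* i′ ℚ.* i) (fromℕ-* (suc n) (n !)) ⟨
    fromℕ (suc n !) ℚ.* i′ ℚ.* i       ≡⟨ cong (ℚ._* i) (fromℕ!*invFact (suc n)) ⟩
    1ℚ ℚ.* i                           ≡⟨ ℚ.*-identityˡ i ⟩
    i                                  ∎
    where
    open ≡.≡-Reasoning
    s = fromℕ (suc n)
    f = fromℕ (n !)
    i = invFact n
    i′ = invFact (suc n)
    open import Algebra.Solver.Ring.NaturalCoefficients.Default (CommutativeRing.commutativeSemiring ℚ.+-*-commutativeRing)
    lemma : ∀ a b c d → a ℚ.* b ℚ.* (c ℚ.* d) ≡ a ℚ.* c ℚ.* b ℚ.* d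
    lemma = solve 4 (λ a b c d → (a :* b) :* (c :* d) := ((a :* c) :* b) :* d) refl

  -- Pairs in a disjoint union of u and w points lie in one of the two sets or meet both. In
  -- exponents of q, the mixed term u w is the coefficient form of E'(t) = E(qt).
  C2-+ : ∀ u w → (u ℕ.+ w) C 2 ≡ u C 2 ℕ.+ w C 2 ℕ.+ u ℕ.* w
  C2-+ zero    w = ≡.sym (ℕ.+-identityʳ (w C 2))
  C2-+ (suc u) w = begin
    suc (u ℕ.+ w) C 2                             ≡⟨ C2-suc (u ℕ.+ w) ⟩
    u ℕ.+ w ℕ.+ (u ℕ.+ w) C 2                     ≡⟨ cong (u ℕ.+ w ℕ.+_) (C2-+ u w) ⟩
    u ℕ.+ w ℕ.+ (u C 2 ℕ.+ w C 2 ℕ.+ u ℕ.* w)     ≡⟨ lemma u w (u C 2) (w C 2) (u ℕ.* w) ⟩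
    u ℕ.+ u C 2 ℕ.+ w C 2 ℕ.+ (w ℕ.+ u ℕ.* w)     ≡⟨ cong (λ z → z ℕ.+ w C 2 ℕ.+ (w ℕ.+ u ℕ.* w)) (C2-suc u) ⟨
    suc u C 2 ℕ.+ w C 2 ℕ.+ suc u ℕ.* w           ∎
    where
    open ≡.≡-Reasoning
    C2-suc : ∀ n → suc n C 2 ≡ n ℕ.+ n C 2
    C2-suc n = ≡.trans (≡.sym (nCk+nC[k+1]≡[n+1]C[k+1] n 1)) (cong (ℕ._+ n C 2) (nC1≡n n))
    open import Data.Nat.Solver using (module +-*-Solver)
    open +-*-Solver
    lemma : ∀ u w a b c → u ℕ.+ w ℕ.+ (a ℕ.+ b ℕ.+ c) ≡ u ℕ.+ a ℕ.+ b ℕ.+ (w ℕ.+ c)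
    lemma = solve 5 (λ u w a b c → u :+ w :+ (a :+ b :+ c) := u :+ a :+ b :+ (w :+ c)) refl

open Arithmetic

-- Sums over pairs with a given total.

module Antidiagonal {c ℓ} (R : CommutativeRing c ℓ) where

  open CommutativeRing R renaming (refl to ≈-refl; sym to ≈-sym; trans to ≈-trans)
  open import Relation.Binary.Reasoning.Setoid setoid
  open import Algebra.Solver.Ring.NaturalCoefficients.Default commutativeSemiring
    using (solve; _:=_; _:+_; _:*_)

  +-interchange : ∀ a b x y → (a + b) + (x + y) ≈ (a + x) + (b + y)
  +-interchange = solve 4 (λ a b x y → (a :+ b) :+ (x :+ y) := (a :+ x) :+ (b :+ y)) ≈-refl

  -- ∑ F n = F 0 n + F 1 (n ∸ 1) + ... + F n 0
  ∑ : (ℕ → ℕ → Carrier) → ℕ → Carrier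
  ∑ F zero    = F 0 0
  ∑ F (suc n) = F 0 (suc n) + ∑ (λ k → F (suc k)) n

  ∑-cong : ∀ {F G} n → (∀ k j → k ℕ.+ j ≡ n → F k j ≈ G k j) → ∑ F n ≈ ∑ G n
  ∑-cong zero    F≈G = F≈G 0 0 refl
  ∑-cong (suc n) F≈G = +-cong (F≈G 0 (suc n) refl) (∑-cong n (λ k j eq → F≈G (suc k) j (cong suc eq)))

  ∑-zero : ∀ {F} n → (∀ k j → F k j ≈ 0#) → ∑ F n ≈ 0#
  ∑-zero zero    F≈0 = F≈0 0 0
  ∑-zero (suc n) F≈0 = ≈-trans (+-cong (F≈0 0 (suc n)) (∑-zero n (λ k → F≈0 (suc k)))) (+-identityˡ 0#)

  ∑-+ : ∀ F G n → ∑ (λ k j → F k j + G k j) n ≈ ∑ F n + ∑ G n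
  ∑-+ F G zero    = ≈-refl
  ∑-+ F G (suc n) = ≈-trans (+-congˡ (∑-+ (λ k → F (suc k)) (λ k → G (suc k)) n)) (+-interchange _ _ _ _)

  ∑-*ˡ : ∀ x F n → ∑ (λ k j → x * F k j) n ≈ x * ∑ F n
  ∑-*ˡ x F zero    = ≈-refl
  ∑-*ˡ x F (suc n) = ≈-trans (+-congˡ (∑-*ˡ x (λ k → F (suc k)) n)) (≈-sym (distribˡ x _ _))

  ∑-last : ∀ F n → ∑ F (suc n) ≈ ∑ (λ k j → F k (suc j)) n + F (suc n) 0
  ∑-last F zero    = ≈-refl
  ∑-last F (suc n) = ≈-trans (+-congˡ (∑-last (λ k → F (suc k)) n)) (≈-sym (+-assoc _ _ _))

  -- Both sides run over the triples k + u + v = n. The terms with k = 0 or u = 0 are split off;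
  -- those with k and u both positive form `d`, a double sum of the same shape whose total is
  -- smaller by 2, to which the induction applies.
  ∑-swap : ∀ (F : ℕ → ℕ → ℕ → Carrier) n →
           ∑ (λ k j → ∑ (λ u v → F k u v) j) n ≈ ∑ (λ u j → ∑ (λ k v → F k u v) j) n
  ∑-swap F zero    = ≈-refl
  ∑-swap F (suc n) = begin
    (F 0 0 (suc n) + a) + ∑ (λ k j → ∑ (F (suc k)) j) n                           ≈⟨ +-congˡ (split F n) ⟩
    (F 0 0 (suc n) + a) + (b + d F n)                                             ≈⟨ +-interchange _ _ _ _ ⟩
    (F 0 0 (suc n) + b) + (a + d F n)                                             ≈⟨ +-congˡ (+-congˡ (d-flip n)) ⟩
    (F 0 0 (suc n) + b) + (a + d (λ k u → F u k) n)                               ≈⟨ +-congˡ (≈-sym (split (λ k u → F u k) n)) ⟩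
    (F 0 0 (suc n) + b) + ∑ (λ u j → ∑ (λ k v → F k (suc u) v) j) n               ∎
    where
    a = ∑ (λ u v → F 0 (suc u) v) n
    b = ∑ (λ k v → F (suc k) 0 v) n
    d : (ℕ → ℕ → ℕ → Carrier) → ℕ → Carrier
    d G zero    = 0#
    d G (suc m) = ∑ (λ k j → ∑ (λ u v → G (suc k) (suc u) v) j) m
    d-flip : ∀ m → d F m ≈ d (λ k u → F u k) m
    d-flip zero    = ≈-refl
    d-flip (suc m) = ∑-swap (λ k u → F (suc k) (suc u)) m
    split : ∀ G m → ∑ (λ k j → ∑ (G (suc k)) j) m ≈ ∑ (λ k v → G (suc k) 0 v) m + d G m
    split G zero    = ≈-sym (+-identityʳ _)
    split G (suc m) = begin
      ∑ (λ k j → ∑ (G (suc k)) j) (suc m)                                                        ≈⟨ ∑-last (λ k → ∑ (G (suc k))) m ⟩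
      ∑ (λ k j → G (suc k) 0 (suc j) + ∑ (λ u v → G (suc k) (suc u) v) j) m + G (suc (suc m)) 0 0
        ≈⟨ +-congʳ (∑-+ _ _ m) ⟩
      ∑ (λ k j → G (suc k) 0 (suc j)) m + d G (suc m) + G (suc (suc m)) 0 0                      ≈⟨ rotate _ _ _ ⟩
      ∑ (λ k j → G (suc k) 0 (suc j)) m + G (suc (suc m)) 0 0 + d G (suc m)
        ≈⟨ +-congʳ (≈-sym (∑-last (λ k v → G (suc k) 0 v) m)) ⟩
      ∑ (λ k v → G (suc k) 0 v) (suc m) + d G (suc m)                                            ∎
      where
      rotate : ∀ x y z → x + y + z ≈ x + z + y
      rotate = solve 3 (λ x y z → x :+ y :+ z := x :+ z :+ y) ≈-refl

-- Sums over lists and over boxes of sequences.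

≡ᵇ-+ˡ : ∀ x s v → (x ℕ.+ s ≡ᵇ x ℕ.+ v) ≡ (s ≡ᵇ v)
≡ᵇ-+ˡ zero    s v = refl
≡ᵇ-+ˡ (suc x) s v = ≡ᵇ-+ˡ x s v

<⇒+≢ᵇ : ∀ {m x} → m ℕ.< x → ∀ s → (x ℕ.+ s ≡ᵇ m) ≡ false
<⇒+≢ᵇ {zero}  (s≤s _)   s = refl
<⇒+≢ᵇ {suc m} (s≤s m<x) s = <⇒+≢ᵇ m<x s

hasSum : ℕ → List ℕ → Bool
hasSum m u = sumℕ u ≡ᵇ m

positive : ℕ → Bool
positive x = if isZero x then false else true

isComposition : ℕ → List ℕ → Bool
isComposition m u = hasSum m u ∧ all positive u

module ListSum {c ℓ} (R : CommutativeRing c ℓ) where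

  open CommutativeRing R renaming (refl to ≈-refl; sym to ≈-sym; trans to ≈-trans)
  open import Relation.Binary.Reasoning.Setoid setoid
  open Antidiagonal R

  sum : List Carrier → Carrier
  sum = foldr _+_ 0#

  sum-++ : ∀ xs ys → sum (xs ++ ys) ≈ sum xs + sum ys
  sum-++ []       ys = ≈-sym (+-identityˡ _)
  sum-++ (x ∷ xs) ys = ≈-trans (+-congˡ (sum-++ xs ys)) (≈-sym (+-assoc _ _ _))

  sumOver : ∀ {A : Set} → (A → Carrier) → (A → Bool) → List A → Carrier
  sumOver w p l = sum (map w (filterᵇ p l))

  sum-map-cong : ∀ {A : Set} {f g : A → Carrier} l → (∀ x → f x ≈ g x) → sum (map f l) ≈ sum (map g l)
  sum-map-cong []      f≈g = ≈-refl
  sum-map-cong (x ∷ l) f≈g = +-cong (f≈g x) (sum-map-cong l f≈g)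

  sum-map-*ˡ : ∀ {A : Set} x (f : A → Carrier) l → sum (map (λ a → x * f a) l) ≈ x * sum (map f l)
  sum-map-*ˡ x f []      = ≈-sym (zeroʳ x)
  sum-map-*ˡ x f (a ∷ l) = ≈-trans (+-congˡ (sum-map-*ˡ x f l)) (≈-sym (distribˡ x _ _))

  sum-map-concatMap : ∀ {A B : Set} (w : B → Carrier) (f : A → List B) xs →
                      sum (map w (concatMap f xs)) ≈ sum (map (λ x → sum (map w (f x))) xs)
  sum-map-concatMap w f []       = ≈-refl
  sum-map-concatMap w f (x ∷ xs) = begin
    sum (map w (f x ++ concatMap f xs))                ≡⟨ cong sum (map-++ w (f x) (concatMap f xs)) ⟩
    sum (map w (f x) ++ map w (concatMap f xs))        ≈⟨ sum-++ (map w (f x)) _ ⟩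
    sum (map w (f x)) + sum (map w (concatMap f xs))   ≈⟨ +-congˡ (sum-map-concatMap w f xs) ⟩
    sum (map (λ x → sum (map w (f x))) (x ∷ xs))       ∎

  filterᵇ-concatMap : ∀ {A B : Set} (p : B → Bool) (f : A → List B) xs →
                      filterᵇ p (concatMap f xs) ≡ concatMap (filterᵇ p ∘ f) xs
  filterᵇ-concatMap p f []       = refl
  filterᵇ-concatMap p f (x ∷ xs) = ≡.trans (filter-++ _ (f x) (concatMap f xs))
                                           (cong (filterᵇ p (f x) ++_) (filterᵇ-concatMap p f xs))
    where open import Data.List.Properties using (filter-++)

  sumOver-map : ∀ {A B : Set} (w : B → Carrier) p (f : A → B) l → sumOver w p (map f l) ≡ sumOver (w ∘ f) (p ∘ f) l
  sumOver-map w p f []      = refl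
  sumOver-map w p f (x ∷ l) with p (f x)
  ... | true  = cong (w (f x) +_) (sumOver-map w p f l)
  ... | false = sumOver-map w p f l

  sumOver-cong : ∀ {A : Set} {w w′ : A → Carrier} {p p′} l → (∀ u → w u ≈ w′ u) → (∀ u → p u ≡ p′ u) →
                 sumOver w p l ≈ sumOver w′ p′ l
  sumOver-cong []      w≈ p≡ = ≈-refl
  sumOver-cong {p = p} {p′} (x ∷ l) w≈ p≡ with p x | p′ x | p≡ x
  ... | true  | .true  | refl = +-cong (w≈ x) (sumOver-cong l w≈ p≡)
  ... | false | .false | refl = sumOver-cong l w≈ p≡

  sumOver-none : ∀ {A : Set} {w : A → Carrier} {p} l → (∀ u → p u ≡ false) → sumOver w p l ≈ 0#
  sumOver-none         []      p≡false = ≈-refl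
  sumOver-none {p = p} (x ∷ l) p≡false with p x | p≡false x
  ... | .false | refl = sumOver-none l p≡false

  ∑< : (ℕ → Carrier) → ℕ → Carrier
  ∑< f zero    = 0#
  ∑< f (suc n) = f 0 + ∑< (λ k → f (suc k)) n

  sum-applyUpTo : ∀ f n → sum (applyUpTo f n) ≡ ∑< f n
  sum-applyUpTo f zero    = refl
  sum-applyUpTo f (suc n) = cong (f 0 +_) (sum-applyUpTo (f ∘ suc) n)

  ∑<-cong : ∀ {f g} n → (∀ k → f k ≈ g k) → ∑< f n ≈ ∑< g n
  ∑<-cong zero    f≈g = ≈-refl
  ∑<-cong (suc n) f≈g = +-cong (f≈g 0) (∑<-cong n (f≈g ∘ suc))

  ∑<-zero : ∀ {f} n → (∀ k → f k ≈ 0#) → ∑< f n ≈ 0#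
  ∑<-zero zero    f≈0 = ≈-refl
  ∑<-zero (suc n) f≈0 = ≈-trans (+-cong (f≈0 0) (∑<-zero n (λ k → f≈0 (suc k)))) (+-identityˡ 0#)

  ∑<-*ˡ : ∀ x f n → ∑< (λ k → x * f k) n ≈ x * ∑< f n
  ∑<-*ˡ x f zero    = ≈-sym (zeroʳ x)
  ∑<-*ˡ x f (suc n) = ≈-trans (+-congˡ (∑<-*ˡ x (λ k → f (suc k)) n)) (≈-sym (distribˡ x _ _))

  ∑<-∑-swap : ∀ (F : ℕ → ℕ → ℕ → Carrier) m n → ∑< (λ k → ∑ (F k) m) n ≈ ∑ (λ u v → ∑< (λ k → F k u v) n) m
  ∑<-∑-swap F m zero    = ≈-sym (∑-zero m (λ _ _ → ≈-refl))
  ∑<-∑-swap F m (suc n) = ≈-trans (+-congˡ (∑<-∑-swap (λ k → F (suc k)) m n))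
                                  (≈-sym (∑-+ (F 0) (λ u v → ∑< (λ k → F (suc k) u v) n) m))

  -- The first entry of a sequence in a box ranges over 0..B, but only a value x ≤ m leaves a
  -- remainder m - x for the other entries.
  ∑<-antidiagonal : ∀ {f G m B} → m ℕ.≤ B → (∀ x v → x ℕ.+ v ≡ m → f x ≈ G x v) → (∀ x → m ℕ.< x → f x ≈ 0#) →
                    ∑< f (suc B) ≈ ∑ G m
  ∑<-antidiagonal {B = B} z≤n       f≈G f≈0 =
    ≈-trans (+-cong (f≈G 0 0 refl) (∑<-zero B (λ k → f≈0 (suc k) (s≤s z≤n)))) (+-identityʳ _)
  ∑<-antidiagonal (s≤s m≤B) f≈G f≈0 =
    +-cong (f≈G 0 _ refl) (∑<-antidiagonal m≤B (λ x v eq → f≈G (suc x) v (cong suc eq)) (λ x m<x → f≈0 (suc x) (s≤s m<x)))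

  sumOver-boxLists-suc : ∀ w p L B →
    sumOver w p (boxLists (suc L) B) ≈ ∑< (λ x → sumOver (w ∘ (x ∷_)) (p ∘ (x ∷_)) (boxLists L B)) (suc B)
  sumOver-boxLists-suc w p L B = begin
    sum (map w (filterᵇ p (concatMap f (upTo (suc B)))))
      ≡⟨ cong (sum ∘ map w) (filterᵇ-concatMap p f (upTo (suc B))) ⟩
    sum (map w (concatMap (filterᵇ p ∘ f) (upTo (suc B))))
      ≈⟨ sum-map-concatMap w (filterᵇ p ∘ f) (upTo (suc B)) ⟩
    sum (map (λ x → sumOver w p (f x)) (upTo (suc B)))
      ≡⟨ cong sum (map-applyUpTo (λ x → x) (λ x → sumOver w p (f x)) (suc B)) ⟩
    sum (applyUpTo (λ x → sumOver w p (f x)) (suc B))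
      ≡⟨ sum-applyUpTo (λ x → sumOver w p (f x)) (suc B) ⟩
    ∑< (λ x → sumOver w p (f x)) (suc B)
      ≈⟨ ∑<-cong (suc B) (λ x → reflexive (sumOver-map w p (x ∷_) (boxLists L B))) ⟩
    ∑< (λ x → sumOver (w ∘ (x ∷_)) (p ∘ (x ∷_)) (boxLists L B)) (suc B) ∎
    where
    f : ℕ → List (List ℕ)
    f x = map (x ∷_) (boxLists L B)

-- coefficient of y^r in (y - 1)^(r+m)
signedBinomial : ℕ → ℕ → ℚ
signedBinomial zero    zero    = 1ℚ
signedBinomial zero    (suc m) = ℚ.- signedBinomial zero m
signedBinomial (suc r) zero    = signedBinomial r zero
signedBinomial (suc r) (suc m) = signedBinomial r (suc m) ℚ.- signedBinomial (suc r) m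

-- Symmetric functions through their monomial coefficients.

module SymmetricFunctions where

  open import Data.Rational using (_+_; _*_; -_; _-_)
  open Antidiagonal ℚ.+-*-commutativeRing
  open import Algebra.Solver.Ring.NaturalCoefficients.Default (CommutativeRing.commutativeSemiring ℚ.+-*-commutativeRing)
    using (solve; _:=_; _:+_; _:*_)

  -- multiplication by e_k, acting on monomial coefficients
  eMul : ℕ → (List ℕ → ℚ) → List ℕ → ℚ
  eMul zero    h a           = h a
  eMul (suc k) h []          = 0ℚ
  eMul (suc k) h (zero ∷ a)  = eMul (suc k) (h ∘ (0 ∷_)) a
  eMul (suc k) h (suc x ∷ a) = eMul (suc k) (h ∘ (suc x ∷_)) a + eMul k (h ∘ (x ∷_)) a

  eCoeffℚ : List ℕ → List ℕ → ℚ
  eCoeffℚ μ a = fromℕ (eCoeff μ a)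

  eMul-cong : ∀ k {h h′} a → (∀ b → h b ≡ h′ b) → eMul k h a ≡ eMul k h′ a
  eMul-cong zero    a           h≡ = h≡ a
  eMul-cong (suc k) []          h≡ = refl
  eMul-cong (suc k) (zero ∷ a)  h≡ = eMul-cong (suc k) a (h≡ ∘ (0 ∷_))
  eMul-cong (suc k) (suc x ∷ a) h≡ = cong₂ _+_ (eMul-cong (suc k) a (h≡ ∘ (suc x ∷_))) (eMul-cong k a (h≡ ∘ (x ∷_)))

  eMul-+ : ∀ k h h′ a → eMul k (λ b → h b + h′ b) a ≡ eMul k h a + eMul k h′ a
  eMul-+ zero    h h′ a           = refl
  eMul-+ (suc k) h h′ []          = refl
  eMul-+ (suc k) h h′ (zero ∷ a)  = eMul-+ (suc k) _ _ a
  eMul-+ (suc k) h h′ (suc x ∷ a) =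
    ≡.trans (cong₂ _+_ (eMul-+ (suc k) (h ∘ (suc x ∷_)) (h′ ∘ (suc x ∷_)) a) (eMul-+ k (h ∘ (x ∷_)) (h′ ∘ (x ∷_)) a))
            (+-interchange (eMul (suc k) (h ∘ (suc x ∷_)) a) _ _ _)

  eMul-*ˡ : ∀ k c h a → eMul k (λ b → c * h b) a ≡ c * eMul k h a
  eMul-*ˡ zero    c h a           = refl
  eMul-*ˡ (suc k) c h []          = ≡.sym (ℚ.*-zeroʳ c)
  eMul-*ˡ (suc k) c h (zero ∷ a)  = eMul-*ˡ (suc k) c _ a
  eMul-*ˡ (suc k) c h (suc x ∷ a) =
    ≡.trans (cong₂ _+_ (eMul-*ˡ (suc k) c (h ∘ (suc x ∷_)) a) (eMul-*ˡ k c (h ∘ (x ∷_)) a)) (≡.sym (ℚ.*-distribˡ-+ c _ _))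

  eMul-zero : ∀ k {h} a → (∀ b → h b ≡ 0ℚ) → eMul k h a ≡ 0ℚ
  eMul-zero zero    a           h≡0 = h≡0 a
  eMul-zero (suc k) []          h≡0 = refl
  eMul-zero (suc k) (zero ∷ a)  h≡0 = eMul-zero (suc k) a (h≡0 ∘ (0 ∷_))
  eMul-zero (suc k) (suc x ∷ a) h≡0 = cong₂ _+_ (eMul-zero (suc k) a (h≡0 ∘ (suc x ∷_))) (eMul-zero k a (h≡0 ∘ (x ∷_)))

  eMul-0∷ : ∀ k h a → eMul k h (0 ∷ a) ≡ eMul k (h ∘ (0 ∷_)) a
  eMul-0∷ zero    h a = refl
  eMul-0∷ (suc k) h a = refl

  eMul-comm : ∀ k l h a → eMul k (eMul l h) a ≡ eMul l (eMul k h) a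
  eMul-comm zero    l       h a          = refl
  eMul-comm (suc k) zero    h a          = refl
  eMul-comm (suc k) (suc l) h []         = refl
  eMul-comm (suc k) (suc l) h (zero ∷ a) = eMul-comm (suc k) (suc l) (h ∘ (0 ∷_)) a
  -- An exponent 1 can be lowered by only one of the two factors, so the fourth term of the general
  -- case is absent here.
  eMul-comm (suc k) (suc l) h (suc zero ∷ a) = begin
    eMul (suc k) (λ b → eMul (suc l) h₁ b + eMul l h₀ b) a + eMul k (eMul (suc l) h₀) a
      ≡⟨ cong (_+ eMul k (eMul (suc l) h₀) a) (eMul-+ (suc k) (eMul (suc l) h₁) (eMul l h₀) a) ⟩
    eMul (suc k) (eMul (suc l) h₁) a + eMul (suc k) (eMul l h₀) a + eMul k (eMul (suc l) h₀) a
      ≡⟨ cong₂ _+_ (cong₂ _+_ (eMul-comm (suc k) (suc l) h₁ a) (eMul-comm (suc k) l h₀ a)) (eMul-comm k (suc l) h₀ a) ⟩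
    eMul (suc l) (eMul (suc k) h₁) a + eMul l (eMul (suc k) h₀) a + eMul (suc l) (eMul k h₀) a
      ≡⟨ solve 3 (λ x y z → (x :+ y) :+ z := (x :+ z) :+ y) refl (eMul (suc l) (eMul (suc k) h₁) a) _ _ ⟩
    eMul (suc l) (eMul (suc k) h₁) a + eMul (suc l) (eMul k h₀) a + eMul l (eMul (suc k) h₀) a
      ≡⟨ cong (_+ eMul l (eMul (suc k) h₀) a) (eMul-+ (suc l) (eMul (suc k) h₁) (eMul k h₀) a) ⟨
    eMul (suc l) (λ b → eMul (suc k) h₁ b + eMul k h₀ b) a + eMul l (eMul (suc k) h₀) a ∎
    where
    open ≡.≡-Reasoning
    h₁ = h ∘ (1 ∷_)
    h₀ = h ∘ (0 ∷_)
  eMul-comm (suc k) (suc l) h (suc (suc x) ∷ a) = begin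
    eMul (suc k) (λ b → eMul (suc l) h₂ b + eMul l h₁ b) a + eMul k (λ b → eMul (suc l) h₁ b + eMul l h₀ b) a
      ≡⟨ cong₂ _+_ (eMul-+ (suc k) (eMul (suc l) h₂) (eMul l h₁) a) (eMul-+ k (eMul (suc l) h₁) (eMul l h₀) a) ⟩
    (eMul (suc k) (eMul (suc l) h₂) a + eMul (suc k) (eMul l h₁) a) + (eMul k (eMul (suc l) h₁) a + eMul k (eMul l h₀) a)
      ≡⟨ cong₂ _+_ (cong₂ _+_ (eMul-comm (suc k) (suc l) h₂ a) (eMul-comm (suc k) l h₁ a))
                   (cong₂ _+_ (eMul-comm k (suc l) h₁ a) (eMul-comm k l h₀ a)) ⟩
    (eMul (suc l) (eMul (suc k) h₂) a + eMul l (eMul (suc k) h₁) a) + (eMul (suc l) (eMul k h₁) a + eMul l (eMul k h₀) a)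
      ≡⟨ +-interchange (eMul (suc l) (eMul (suc k) h₂) a) (eMul l (eMul (suc k) h₁) a) _ _ ⟩
    (eMul (suc l) (eMul (suc k) h₂) a + eMul (suc l) (eMul k h₁) a) + (eMul l (eMul (suc k) h₁) a + eMul l (eMul k h₀) a)
      ≡⟨ cong₂ _+_ (eMul-+ (suc l) (eMul (suc k) h₂) (eMul k h₁) a) (eMul-+ l (eMul (suc k) h₁) (eMul k h₀) a) ⟨
    eMul (suc l) (λ b → eMul (suc k) h₂ b + eMul k h₁ b) a + eMul l (λ b → eMul (suc k) h₁ b + eMul k h₀ b) a ∎
    where
    open ≡.≡-Reasoning
    h₂ = h ∘ (suc (suc x) ∷_)
    h₁ = h ∘ (suc x ∷_)
    h₀ = h ∘ (x ∷_)

  eMul-short : ∀ k h a → length a ℕ.< k → eMul k h a ≡ 0ℚ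
  eMul-short (suc k) h []          _         = refl
  eMul-short (suc k) h (zero ∷ a)  (s≤s a<k) = eMul-short (suc k) _ a (ℕ.m<n⇒m<1+n a<k)
  eMul-short (suc k) h (suc x ∷ a) (s≤s a<k) =
    cong₂ _+_ (eMul-short (suc k) _ a (ℕ.m<n⇒m<1+n a<k)) (eMul-short k _ a a<k)

  -- In N variables e_N is the single monomial x_1 ... x_N. Multiplication by it shifts all
  -- exponents by one and can be undone.
  eMul-map-suc : ∀ h a → eMul (length a) h (map suc a) ≡ h a
  eMul-map-suc h []      = refl
  eMul-map-suc h (x ∷ a) = begin
    eMul (suc (length a)) (h ∘ (suc x ∷_)) (map suc a) + eMul (length a) (h ∘ (x ∷_)) (map suc a)
      ≡⟨ cong₂ _+_ (eMul-short (suc (length a)) _ (map suc a) (s≤s (ℕ.≤-reflexive (length-map suc a)))) (eMul-map-suc (h ∘ (x ∷_)) a) ⟩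
    0ℚ + h (x ∷ a)   ≡⟨ ℚ.+-identityˡ _ ⟩
    h (x ∷ a)        ∎
    where open ≡.≡-Reasoning

  sumℕ-++ : ∀ xs ys → sumℕ (xs ++ ys) ≡ sumℕ xs ℕ.+ sumℕ ys
  sumℕ-++ []       ys = refl
  sumℕ-++ (x ∷ xs) ys = ≡.trans (cong (x ℕ.+_) (sumℕ-++ xs ys)) (≡.sym (ℕ.+-assoc x _ _))

  fromℕ-sum-choose : ∀ k f a → fromℕ (sumℕ (map f (choose k a))) ≡ eMul k (fromℕ ∘ f) a
  fromℕ-sum-choose zero    f a           = cong fromℕ (ℕ.+-identityʳ (f a))
  fromℕ-sum-choose (suc k) f []          = refl
  fromℕ-sum-choose (suc k) f (zero ∷ a)  = begin
    fromℕ (sumℕ (map f (map (0 ∷_) (choose (suc k) a) ++ [])))   ≡⟨ cong (fromℕ ∘ sumℕ ∘ map f) (++-identityʳ (map (0 ∷_) (choose (suc k) a))) ⟩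
    fromℕ (sumℕ (map f (map (0 ∷_) (choose (suc k) a))))         ≡⟨ cong (fromℕ ∘ sumℕ) (map-∘ (choose (suc k) a)) ⟨
    fromℕ (sumℕ (map (f ∘ (0 ∷_)) (choose (suc k) a)))           ≡⟨ fromℕ-sum-choose (suc k) (f ∘ (0 ∷_)) a ⟩
    eMul (suc k) (fromℕ ∘ f ∘ (0 ∷_)) a                          ∎
    where open ≡.≡-Reasoning
  fromℕ-sum-choose (suc k) f (suc x ∷ a) = begin
    fromℕ (sumℕ (map f (map (suc x ∷_) (choose (suc k) a) ++ map (x ∷_) (choose k a))))
      ≡⟨ cong (fromℕ ∘ sumℕ) (map-++ f (map (suc x ∷_) (choose (suc k) a)) _) ⟩
    fromℕ (sumℕ (map f (map (suc x ∷_) (choose (suc k) a)) ++ map f (map (x ∷_) (choose k a))))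
      ≡⟨ cong₂ (λ u v → fromℕ (sumℕ (u ++ v))) (map-∘ (choose (suc k) a)) (map-∘ (choose k a)) ⟨
    fromℕ (sumℕ (map (f ∘ (suc x ∷_)) (choose (suc k) a) ++ map (f ∘ (x ∷_)) (choose k a)))
      ≡⟨ cong fromℕ (sumℕ-++ (map (f ∘ (suc x ∷_)) (choose (suc k) a)) _) ⟩
    fromℕ (sumℕ (map (f ∘ (suc x ∷_)) (choose (suc k) a)) ℕ.+ sumℕ (map (f ∘ (x ∷_)) (choose k a)))
      ≡⟨ fromℕ-+ (sumℕ (map (f ∘ (suc x ∷_)) (choose (suc k) a))) _ ⟩
    fromℕ (sumℕ (map (f ∘ (suc x ∷_)) (choose (suc k) a))) + fromℕ (sumℕ (map (f ∘ (x ∷_)) (choose k a)))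
      ≡⟨ cong₂ _+_ (fromℕ-sum-choose (suc k) (f ∘ (suc x ∷_)) a) (fromℕ-sum-choose k (f ∘ (x ∷_)) a) ⟩
    eMul (suc k) (fromℕ ∘ f) (suc x ∷ a) ∎
    where open ≡.≡-Reasoning

  eCoeffℚ-∷ : ∀ k μ a → eCoeffℚ (k ∷ μ) a ≡ eMul k (eCoeffℚ μ) a
  eCoeffℚ-∷ k μ a = fromℕ-sum-choose k (eCoeff μ) a

  eCoeffℚ-↭ : ∀ {μ ν} → μ ↭ ν → ∀ a → eCoeffℚ μ a ≡ eCoeffℚ ν a
  eCoeffℚ-↭ Perm.refl a = refl
  eCoeffℚ-↭ {_ ∷ μ} {_ ∷ ν} (Perm.prep k p) a =
    ≡.trans (eCoeffℚ-∷ k μ a) (≡.trans (eMul-cong k a (eCoeffℚ-↭ p)) (≡.sym (eCoeffℚ-∷ k ν a)))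
  eCoeffℚ-↭ {_ ∷ _ ∷ μ} {_ ∷ _ ∷ ν} (Perm.swap k l p) a = begin
    eCoeffℚ (k ∷ l ∷ μ) a           ≡⟨ two k l μ ⟩
    eMul k (eMul l (eCoeffℚ μ)) a   ≡⟨ eMul-comm k l (eCoeffℚ μ) a ⟩
    eMul l (eMul k (eCoeffℚ μ)) a   ≡⟨ eMul-cong l a (λ b → eMul-cong k b (eCoeffℚ-↭ p)) ⟩
    eMul l (eMul k (eCoeffℚ ν)) a   ≡⟨ two l k ν ⟨
    eCoeffℚ (l ∷ k ∷ ν) a           ∎
    where
    open ≡.≡-Reasoning
    two : ∀ k l μ → eCoeffℚ (k ∷ l ∷ μ) a ≡ eMul k (eMul l (eCoeffℚ μ)) a
    two k l μ = ≡.trans (eCoeffℚ-∷ k (l ∷ μ) a) (eMul-cong k a (eCoeffℚ-∷ l μ))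
  eCoeffℚ-↭ (Perm.trans p p′) a = ≡.trans (eCoeffℚ-↭ p a) (eCoeffℚ-↭ p′ a)

  eCoeffℚ-0∷ : ∀ μ a → eCoeffℚ μ (0 ∷ a) ≡ eCoeffℚ μ a
  eCoeffℚ-0∷ []      a = refl
  eCoeffℚ-0∷ (k ∷ μ) a = begin
    eCoeffℚ (k ∷ μ) (0 ∷ a)               ≡⟨ eCoeffℚ-∷ k μ (0 ∷ a) ⟩
    eMul k (eCoeffℚ μ) (0 ∷ a)            ≡⟨ eMul-0∷ k (eCoeffℚ μ) a ⟩
    eMul k (eCoeffℚ μ ∘ (0 ∷_)) a         ≡⟨ eMul-cong k a (eCoeffℚ-0∷ μ) ⟩
    eMul k (eCoeffℚ μ) a                  ≡⟨ eCoeffℚ-∷ k μ a ⟨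
    eCoeffℚ (k ∷ μ) a                     ∎
    where open ≡.≡-Reasoning

  eCoeffℚ-head0 : ∀ μ a → eCoeffℚ (0 ∷ μ) a ≡ eCoeffℚ μ a
  eCoeffℚ-head0 = eCoeffℚ-∷ 0

  -- Functionals on e-expansions and algebraic independence.

  -- linear extension of G from the products e_μ to e-expansions
  lin : EExpr → (List ℕ → ℚ) → ℚ
  lin []            G = 0ℚ
  lin ((c , μ) ∷ E) G = c * G μ + lin E G

  lin-cong : ∀ {P : List ℕ → Set} {E} → All (P ∘ proj₂) E → ∀ {G G′} → (∀ μ → P μ → G μ ≡ G′ μ) → lin E G ≡ lin E G′
  lin-cong []         G≡ = refl
  lin-cong {E = (c , μ) ∷ E} (p ∷ ps) G≡ = cong₂ _+_ (cong (c *_) (G≡ μ p)) (lin-cong ps G≡)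

  lin-ext : ∀ E {G G′} → (∀ μ → G μ ≡ G′ μ) → lin E G ≡ lin E G′
  lin-ext []            G≡ = refl
  lin-ext ((c , μ) ∷ E) G≡ = cong₂ _+_ (cong (c *_) (G≡ μ)) (lin-ext E G≡)

  lin-zero : ∀ E {G} → (∀ μ → G μ ≡ 0ℚ) → lin E G ≡ 0ℚ
  lin-zero []            G≡0 = refl
  lin-zero ((c , μ) ∷ E) G≡0 = cong₂ _+_ (≡.trans (cong (c *_) (G≡0 μ)) (ℚ.*-zeroʳ c)) (lin-zero E G≡0)

  lin-const : ∀ E g → lin E (λ _ → g) ≡ lin E (λ _ → 1ℚ) * g
  lin-const []            g = ≡.sym (ℚ.*-zeroˡ g)
  lin-const ((c , μ) ∷ E) g = begin
    c * g + lin E (λ _ → g)               ≡⟨ cong₂ (λ u v → u * g + v) (≡.sym (ℚ.*-identityʳ c)) (lin-const E g) ⟩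
    c * 1ℚ * g + lin E (λ _ → 1ℚ) * g     ≡⟨ ℚ.*-distribʳ-+ g (c * 1ℚ) _ ⟨
    (c * 1ℚ + lin E (λ _ → 1ℚ)) * g       ∎
    where open ≡.≡-Reasoning

  lin-++ : ∀ E E′ G → lin (E ++ E′) G ≡ lin E G + lin E′ G
  lin-++ []            E′ G = ≡.sym (ℚ.+-identityˡ _)
  lin-++ ((c , μ) ∷ E) E′ G = ≡.trans (cong (c * G μ +_) (lin-++ E E′ G)) (≡.sym (ℚ.+-assoc (c * G μ) _ _))

  mulTerm : ℚ → ℕ → EExpr → EExpr
  mulTerm c k = map (λ t → c * proj₁ t , k ∷ proj₂ t)

  lin-mulTerm : ∀ c k E G → lin (mulTerm c k E) G ≡ c * lin E (G ∘ (k ∷_))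
  lin-mulTerm c k []            G = ≡.sym (ℚ.*-zeroʳ c)
  lin-mulTerm c k ((d , μ) ∷ E) G = begin
    c * d * G (k ∷ μ) + lin (mulTerm c k E) G          ≡⟨ cong₂ _+_ (ℚ.*-assoc c d _) (lin-mulTerm c k E G) ⟩
    c * (d * G (k ∷ μ)) + c * lin E (G ∘ (k ∷_))       ≡⟨ ℚ.*-distribˡ-+ c _ _ ⟨
    c * (d * G (k ∷ μ) + lin E (G ∘ (k ∷_)))           ∎
    where open ≡.≡-Reasoning

  -- The functions of μ that depend only on the monomial in e_1, e_2, ... denoted by μ, where e_0 =
  -- 1. Independence of the e_k is stated dually, by letting all of these functions annihilate an
  -- expression, so that no normal form of expressions is required.
  record Invariant (G : List ℕ → ℚ) : Set where
    field
      perm  : ∀ {μ ν} → μ ↭ ν → G μ ≡ G ν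
      drop0 : ∀ μ → G (0 ∷ μ) ≡ G μ
  open Invariant

  Vanishing : ℕ → EExpr → Set
  Vanishing N E = ∀ a → length a ≡ N → lin E (λ μ → eCoeffℚ μ a) ≡ 0ℚ

  -- Both bounds serve the induction for independence: discarding the largest index lowers `N`, and
  -- removing one factor lowers `d`.
  Bounded : ℕ → ℕ → List ℕ → Set
  Bounded N d μ = All (ℕ._≤ N) μ × length μ ℕ.≤ d

  extract-max : ∀ N {μ} → All (ℕ._≤ suc N) μ → All (ℕ._≤ N) μ ⊎ ∃ λ ν → μ ↭ suc N ∷ ν
  extract-max N []                = inj₁ []
  extract-max N {x ∷ μ} (x≤ ∷ μ≤) with ℕ.m≤n⇒m<n∨m≡n x≤ | extract-max N μ≤
  ... | inj₂ refl      | _              = inj₂ (μ , Perm.refl)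
  ... | inj₁ (s≤s x≤N) | inj₁ μ≤N       = inj₁ (x≤N ∷ μ≤N)
  ... | inj₁ _         | inj₂ (ν , μ↭) = inj₂ (x ∷ ν , Perm.trans (Perm.prep x μ↭) (Perm.swap x (suc N) Perm.refl))

  -- A decomposition E = E₀ + e_{N+1} E₁ with E₀ free of e_{N+1}. One factor e_{N+1} is taken out
  -- even where several occur, so E₁ keeps the index bound and loses one in length.
  record Split (N d : ℕ) (E : EExpr) : Set where
    field
      without with′  : EExpr
      without-bounded : All (Bounded N (suc d) ∘ proj₂) without
      with-bounded    : All (Bounded (suc N) d ∘ proj₂) with′
      lin-split       : ∀ G → (∀ {μ ν} → μ ↭ ν → G μ ≡ G ν) → lin E G ≡ lin without G + lin with′ (G ∘ (suc N ∷_))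
  open Split

  split : ∀ N d {E} → All (Bounded (suc N) (suc d) ∘ proj₂) E → Split N d E
  split N d [] = record { without = [] ; with′ = [] ; without-bounded = [] ; with-bounded = [] ; lin-split = λ _ _ → refl }
  split N d {(c , μ) ∷ E} ((μ≤ , ∣μ∣≤) ∷ bs) with extract-max N μ≤ | split N d bs
  ... | inj₁ μ≤N | s = record
    { without = (c , μ) ∷ without s ; with′ = with′ s
    ; without-bounded = (μ≤N , ∣μ∣≤) ∷ without-bounded s ; with-bounded = with-bounded s
    ; lin-split = λ G inv → ≡.trans (cong (c * G μ +_) (lin-split s G inv)) (≡.sym (ℚ.+-assoc (c * G μ) _ _)) }
  ... | inj₂ (ν , μ↭) | s = record
    { without = without s ; with′ = (c , ν) ∷ with′ s
    ; without-bounded = without-bounded s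
    ; with-bounded = (All.tail (All-resp-↭ μ↭ μ≤) , ℕ.≤-pred (subst (ℕ._≤ suc d) (↭-length μ↭) ∣μ∣≤)) ∷ with-bounded s
    ; lin-split = λ G inv → ≡.trans (cong₂ _+_ (cong (c *_) (inv μ↭)) (lin-split s G inv))
        (solve 3 (λ x y z → x :+ (y :+ z) := y :+ (x :+ z)) refl (c * G (suc N ∷ ν)) (lin (without s) G) _) }

  eCoeffℚ-[] : ∀ n → eCoeffℚ [] (replicate n 0) ≡ 1ℚ
  eCoeffℚ-[] zero    = refl
  eCoeffℚ-[] (suc n) = eCoeffℚ-[] n

  -- The base cases: every product in E equals 1, so E is a scalar, and this scalar is the
  -- coefficient of the monomial with all exponents 0.
  lin-constant-vanishes : ∀ {P : List ℕ → Set} {N E} → All (P ∘ proj₂) E →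
    (∀ {G} → Invariant G → ∀ μ → P μ → G μ ≡ G []) → Vanishing N E → ∀ {G} → Invariant G → lin E G ≡ 0ℚ
  lin-constant-vanishes {P} {N} {E} ps const vanish {G} inv = begin
    lin E G                              ≡⟨ lin-cong ps (const inv) ⟩
    lin E (λ _ → G [])                   ≡⟨ lin-const E (G []) ⟩
    lin E (λ _ → 1ℚ) * G []              ≡⟨ cong (_* G []) (lin-cong ps (λ μ p → ≡.sym (≡.trans (const eInv μ p) (eCoeffℚ-[] N)))) ⟩
    lin E (λ μ → eCoeffℚ μ a₀) * G []    ≡⟨ cong (_* G []) (vanish a₀ (length-replicate N)) ⟩
    0ℚ * G []                            ≡⟨ ℚ.*-zeroˡ (G []) ⟩
    0ℚ                                   ∎
    where
    open ≡.≡-Reasoning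
    a₀ = replicate N 0
    eInv : Invariant (λ μ → eCoeffℚ μ a₀)
    eInv = record { perm = λ p → eCoeffℚ-↭ p a₀ ; drop0 = λ μ → eCoeffℚ-head0 μ a₀ }

  -- Algebraic independence of e_1, ..., e_N in N variables: setting one variable to 0 isolates the
  -- terms without e_N, and e_N = x_1 ... x_N can be cancelled from the remaining ones.
  vanishing⇒lin≡0 : ∀ N d {E} → All (Bounded N d ∘ proj₂) E → Vanishing N E → ∀ {G} → Invariant G → lin E G ≡ 0ℚ
  vanishing⇒lin≡0 zero d bs = lin-constant-vanishes bs (λ inv μ b → const inv μ (proj₁ b))
    where
    const : ∀ {G} → Invariant G → ∀ μ → All (ℕ._≤ 0) μ → G μ ≡ G []
    const inv []      []         = refl
    const inv (0 ∷ μ) (z≤n ∷ ps) = ≡.trans (drop0 inv μ) (const inv μ ps)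
  vanishing⇒lin≡0 (suc N) zero bs = lin-constant-vanishes bs λ { inv [] _ → refl ; inv (_ ∷ _) (_ , ()) }
  vanishing⇒lin≡0 (suc N) (suc d) {E} bs vanish {G} inv = begin
    lin E G                                     ≡⟨ lin-split s G (perm inv) ⟩
    lin E₀ G + lin E₁ (G ∘ (suc N ∷_))          ≡⟨ cong₂ _+_ (lin-E₀ inv) (vanishing⇒lin≡0 (suc N) d (with-bounded s) vanish₁ inv′) ⟩
    0ℚ                                          ∎
    where
    open ≡.≡-Reasoning
    s = split N d bs
    E₀ = without s
    E₁ = with′ s
    vanish₀ : Vanishing N E₀
    vanish₀ b ∣b∣≡N = begin
      lin E₀ (λ μ → eCoeffℚ μ b)                             ≡⟨ ℚ.+-identityʳ _ ⟨
      lin E₀ (λ μ → eCoeffℚ μ b) + 0ℚ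
        ≡⟨ cong₂ _+_ (lin-ext E₀ (λ μ → eCoeffℚ-0∷ μ b)) (lin-zero E₁ (λ μ →
             ≡.trans (eCoeffℚ-0∷ (suc N ∷ μ) b) (≡.trans (eCoeffℚ-∷ (suc N) μ b)
               (eMul-short (suc N) _ b (s≤s (ℕ.≤-reflexive ∣b∣≡N)))))) ⟨
      lin E₀ (λ μ → eCoeffℚ μ (0 ∷ b)) + lin E₁ (λ μ → eCoeffℚ (suc N ∷ μ) (0 ∷ b))
        ≡⟨ lin-split s _ (λ p → eCoeffℚ-↭ p (0 ∷ b)) ⟨
      lin E (λ μ → eCoeffℚ μ (0 ∷ b))                        ≡⟨ vanish (0 ∷ b) (cong suc ∣b∣≡N) ⟩
      0ℚ                                                     ∎
    -- Vanishing of E₀ is known in N variables only. Because the conclusion covers every invariant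
    -- functional, it may be applied to coefficients in N + 1 variables as well, which removes E₀
    -- from `vanish₁`.
    lin-E₀ : ∀ {G} → Invariant G → lin E₀ G ≡ 0ℚ
    lin-E₀ = vanishing⇒lin≡0 N (suc d) (without-bounded s) vanish₀
    vanish₁ : Vanishing (suc N) E₁
    vanish₁ a ∣a∣≡N = begin
      lin E₁ (λ μ → eCoeffℚ μ a)                             ≡⟨ lin-ext E₁ (λ μ → ≡.trans (eCoeffℚ-∷ (suc N) μ (map suc a)) (cancel μ)) ⟨
      lin E₁ (λ μ → eCoeffℚ (suc N ∷ μ) (map suc a))         ≡⟨ ℚ.+-identityˡ _ ⟨
      0ℚ + lin E₁ (λ μ → eCoeffℚ (suc N ∷ μ) (map suc a))
        ≡⟨ cong (_+ lin E₁ (λ μ → eCoeffℚ (suc N ∷ μ) (map suc a))) (lin-E₀ {λ μ → eCoeffℚ μ (map suc a)} eInv) ⟨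
      lin E₀ (λ μ → eCoeffℚ μ (map suc a)) + lin E₁ (λ μ → eCoeffℚ (suc N ∷ μ) (map suc a))
        ≡⟨ lin-split s _ (perm eInv) ⟨
      lin E (λ μ → eCoeffℚ μ (map suc a))                    ≡⟨ vanish (map suc a) (≡.trans (length-map suc a) ∣a∣≡N) ⟩
      0ℚ                                                     ∎
      where
      cancel : ∀ μ → eMul (suc N) (eCoeffℚ μ) (map suc a) ≡ eCoeffℚ μ a
      cancel μ = subst (λ n → eMul n (eCoeffℚ μ) (map suc a) ≡ eCoeffℚ μ a) ∣a∣≡N (eMul-map-suc (eCoeffℚ μ) a)
      eInv : Invariant (λ μ → eCoeffℚ μ (map suc a))
      eInv = record { perm = λ p → eCoeffℚ-↭ p (map suc a) ; drop0 = λ μ → eCoeffℚ-head0 μ (map suc a) }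
    inv′ : Invariant (G ∘ (suc N ∷_))
    inv′ = record
      { perm  = λ p → perm inv (Perm.prep (suc N) p)
      ; drop0 = λ μ → ≡.trans (perm inv (Perm.swap (suc N) 0 Perm.refl)) (drop0 inv (suc N ∷ μ)) }

  bounded : ∀ (E : EExpr) → ∃₂ λ N d → All (Bounded N d ∘ proj₂) E
  bounded []            = 0 , 0 , []
  bounded ((c , μ) ∷ E) with bounded E
  ... | N , d , bs = sumℕ μ ℕ.⊔ N , length μ ℕ.⊔ d ,
    (All.map (λ x≤ → ℕ.≤-trans x≤ (ℕ.m≤m⊔n _ N)) (≤sumℕ μ) , ℕ.m≤m⊔n _ d) ∷
    All.map (λ { (b , l) → All.map (λ x≤ → ℕ.≤-trans x≤ (ℕ.m≤n⊔m (sumℕ μ) N)) b , ℕ.≤-trans l (ℕ.m≤n⊔m (length μ) d) }) bs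
    where
    ≤sumℕ : ∀ μ → All (ℕ._≤ sumℕ μ) μ
    ≤sumℕ []      = []
    ≤sumℕ (x ∷ μ) = ℕ.m≤m+n x (sumℕ μ) ∷ All.map (λ y≤ → ℕ.≤-trans y≤ (ℕ.m≤n+m (sumℕ μ) x)) (≤sumℕ μ)

  lin-unique : ∀ E E′ → (∀ a → lin E (λ μ → eCoeffℚ μ a) ≡ lin E′ (λ μ → eCoeffℚ μ a)) →
               ∀ {G} → Invariant G → lin E G ≡ lin E′ G
  -- The difference E - E′ is formed by multiplying E′ with -e_0, which an invariant functional sees
  -- as -1. N is taken so large that no index exceeds the number of variables.
  lin-unique E E′ eq {G} inv with bounded (E ++ mulTerm (- 1ℚ) 0 E′)
  ... | N , d , bs = begin
    lin E G                                        ≡⟨ ℚ.+-identityʳ _ ⟨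
    lin E G + 0ℚ                                   ≡⟨ cong (lin E G +_) (ℚ.+-inverseˡ (lin E′ G)) ⟨
    lin E G + (- lin E′ G + lin E′ G)              ≡⟨ ℚ.+-assoc (lin E G) _ _ ⟨
    lin E G + - lin E′ G + lin E′ G                ≡⟨ cong (_+ lin E′ G) (difference G inv) ⟨
    lin (E ++ mulTerm (- 1ℚ) 0 E′) G + lin E′ G    ≡⟨ cong (_+ lin E′ G) (vanishing⇒lin≡0 N d bs vanish inv) ⟩
    0ℚ + lin E′ G                                  ≡⟨ ℚ.+-identityˡ _ ⟩
    lin E′ G                                       ∎
    where
    open ≡.≡-Reasoning
    difference : ∀ G → Invariant G → lin (E ++ mulTerm (- 1ℚ) 0 E′) G ≡ lin E G + - lin E′ G
    difference G inv = begin
      lin (E ++ mulTerm (- 1ℚ) 0 E′) G         ≡⟨ lin-++ E _ G ⟩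
      lin E G + lin (mulTerm (- 1ℚ) 0 E′) G    ≡⟨ cong (lin E G +_) (lin-mulTerm (- 1ℚ) 0 E′ G) ⟩
      lin E G + - 1ℚ * lin E′ (G ∘ (0 ∷_))     ≡⟨ cong (λ z → lin E G + - 1ℚ * z) (lin-ext E′ (drop0 inv)) ⟩
      lin E G + - 1ℚ * lin E′ G                ≡⟨ cong (lin E G +_) (≡.sym (ℚ.neg-distribˡ-* 1ℚ (lin E′ G))) ⟩
      lin E G + - (1ℚ * lin E′ G)              ≡⟨ cong (λ z → lin E G + - z) (ℚ.*-identityˡ (lin E′ G)) ⟩
      lin E G + - lin E′ G                     ∎
    vanish : Vanishing N (E ++ mulTerm (- 1ℚ) 0 E′)
    vanish a _ = begin
      lin (E ++ mulTerm (- 1ℚ) 0 E′) F         ≡⟨ difference F (record { perm = λ p → eCoeffℚ-↭ p a ; drop0 = λ μ → eCoeffℚ-head0 μ a }) ⟩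
      lin E F + - lin E′ F                     ≡⟨ cong (_+ - lin E′ F) (eq a) ⟩
      lin E′ F + - lin E′ F                    ≡⟨ ℚ.+-inverseʳ (lin E′ F) ⟩
      0ℚ                                       ∎
      where
      F = λ μ → eCoeffℚ μ a

  -- The functions p_n^{(r)} and their e-expansions.

  -- coefficients of p_{r+m}^{(r)}: r nonzero exponents, which exceed 1 by m in total
  pCoeffℚ : ℕ → ℕ → List ℕ → ℚ
  pCoeffℚ zero    m       []                = if 0 ≡ᵇ m then 1ℚ else 0ℚ
  pCoeffℚ (suc r) m       []                = 0ℚ
  pCoeffℚ r       m       (zero ∷ a)        = pCoeffℚ r m a
  pCoeffℚ zero    m       (suc x ∷ a)       = 0ℚ
  pCoeffℚ (suc r) m       (suc zero ∷ a)    = pCoeffℚ r m a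
  pCoeffℚ (suc r) zero    (suc (suc x) ∷ a) = 0ℚ
  pCoeffℚ (suc r) (suc m) (suc (suc x) ∷ a) = pCoeffℚ (suc r) m (suc x ∷ a)

  pCoeffℚ-correct : ∀ r m a → pCoeffℚ r m a ≡ fromℕ (pCoeff (r ℕ.+ m) r a)
  pCoeffℚ-correct zero    zero    []                = refl
  pCoeffℚ-correct zero    (suc m) []                = refl
  pCoeffℚ-correct (suc r) m       []                = refl
  pCoeffℚ-correct zero    m       (zero ∷ a)        = pCoeffℚ-correct zero m a
  pCoeffℚ-correct (suc r) m       (zero ∷ a)        = pCoeffℚ-correct (suc r) m a
  pCoeffℚ-correct zero    m       (suc x ∷ a)       =
    cong (λ b → fromℕ (if b then 1 else 0)) (≡.sym (Bool.∧-zeroʳ (sumℕ (suc x ∷ a) ≡ᵇ m)))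
  pCoeffℚ-correct (suc r) m       (suc zero ∷ a)    = pCoeffℚ-correct r m a
  -- If the degree equals the number of nonzero exponents, each of these is 1, which excludes an
  -- exponent of at least 2.
  pCoeffℚ-correct (suc r) zero    (suc (suc x) ∷ a) =
    cong (λ b → fromℕ (if b then 1 else 0)) (≡.sym (impossible r x a))
    where
    nonzeros≤sumℕ : ∀ a → nonzeros a ℕ.≤ sumℕ a
    nonzeros≤sumℕ []          = z≤n
    nonzeros≤sumℕ (zero ∷ a)  = nonzeros≤sumℕ a
    nonzeros≤sumℕ (suc x ∷ a) = s≤s (ℕ.≤-trans (nonzeros≤sumℕ a) (ℕ.m≤n+m (sumℕ a) x))
    >⇒≢ᵇ : ∀ {m n} → n ℕ.< m → (m ≡ᵇ n) ≡ false
    >⇒≢ᵇ {suc m} {zero}  n<m       = refl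
    >⇒≢ᵇ {suc m} {suc n} (s≤s n<m) = >⇒≢ᵇ n<m
    impossible : ∀ r x a → ((suc (x ℕ.+ sumℕ a) ≡ᵇ r ℕ.+ 0) ∧ (nonzeros a ≡ᵇ r)) ≡ false
    impossible r x a with nonzeros a ≡ᵇ r in eq
    ... | false = Bool.∧-zeroʳ _
    ... | true  = ≡.trans (Bool.∧-identityʳ _) (>⇒≢ᵇ (s≤s (begin
      r ℕ.+ 0          ≡⟨ ℕ.+-identityʳ r ⟩
      r                ≡⟨ ℕ.≡ᵇ⇒≡ (nonzeros a) r (subst Bool.T (≡.sym eq) _) ⟨
      nonzeros a       ≤⟨ nonzeros≤sumℕ a ⟩
      sumℕ a           ≤⟨ ℕ.m≤n+m (sumℕ a) x ⟩
      x ℕ.+ sumℕ a     ∎)))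
      where
      open ℕ.≤-Reasoning
  pCoeffℚ-correct (suc r) (suc m) (suc (suc x) ∷ a) = ≡.trans (pCoeffℚ-correct (suc r) m (suc x ∷ a))
    (cong (λ n → fromℕ (if (suc (x ℕ.+ sumℕ a) ≡ᵇ n) ∧ (nonzeros a ≡ᵇ r) then 1 else 0)) (≡.sym (ℕ.+-suc r m)))

  sign : ℕ → ℚ
  sign zero    = 1ℚ
  sign (suc k) = - sign k

  -- multiplication of the series with t^j-coefficient F j by E(-t)
  alternating : (ℕ → List ℕ → ℚ) → ℕ → List ℕ → ℚ
  alternating F m a = ∑ (λ k j → sign k * eMul k (F j) a) m

  ∑-neg : ∀ F n → ∑ (λ k j → - F k j) n ≡ - ∑ F n
  ∑-neg F zero    = refl
  ∑-neg F (suc n) = ≡.trans (cong (- F 0 (suc n) +_) (∑-neg (λ k → F (suc k)) n)) (≡.sym (ℚ.neg-distrib-+ (F 0 (suc n)) _))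

  ∑-sign-suc : ∀ (f : ℕ → ℕ → ℚ) n → ∑ (λ k j → sign (suc k) * f k j) n ≡ - ∑ (λ k j → sign k * f k j) n
  ∑-sign-suc f n = ≡.trans (∑-cong n (λ k j _ → ≡.sym (ℚ.neg-distribˡ-* (sign k) (f k j)))) (∑-neg _ n)

  alternating-zero : ∀ {F} m a → (∀ j b → F j b ≡ 0ℚ) → alternating F m a ≡ 0ℚ
  alternating-zero m a F≡0 = ∑-zero m (λ k j → ≡.trans (cong (sign k *_) (eMul-zero k a (F≡0 j))) (ℚ.*-zeroʳ (sign k)))

  alternating-0∷ : ∀ F m a → alternating F m (0 ∷ a) ≡ alternating (λ j → F j ∘ (0 ∷_)) m a
  alternating-0∷ F m a = ∑-cong m (λ k j _ → cong (sign k *_) (eMul-0∷ k (F j) a))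

  -- E(-t) is the product of the factors 1 - x_i t. The two terms come from 1 and from -x_1 t in the
  -- factor of the first variable.
  alternating-suc∷ : ∀ F m x a → alternating F (suc m) (suc x ∷ a) ≡
                     alternating (λ j → F j ∘ (suc x ∷_)) (suc m) a - alternating (λ j → F j ∘ (x ∷_)) m a
  alternating-suc∷ F m x a = begin
    1ℚ * F (suc m) (suc x ∷ a) + ∑ (λ k j → sign (suc k) * (f k j + g k j)) m
      ≡⟨ cong (1ℚ * F (suc m) (suc x ∷ a) +_) (∑-cong m (λ k j _ → ℚ.*-distribˡ-+ (sign (suc k)) (f k j) (g k j))) ⟩
    1ℚ * F (suc m) (suc x ∷ a) + ∑ (λ k j → sign (suc k) * f k j + sign (suc k) * g k j) m
      ≡⟨ cong (1ℚ * F (suc m) (suc x ∷ a) +_) (∑-+ (λ k j → sign (suc k) * f k j) (λ k j → sign (suc k) * g k j) m) ⟩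
    1ℚ * F (suc m) (suc x ∷ a) + (∑ (λ k j → sign (suc k) * f k j) m + ∑ (λ k j → sign (suc k) * g k j) m)
      ≡⟨ ℚ.+-assoc (1ℚ * F (suc m) (suc x ∷ a)) _ _ ⟨
    alternating (λ j → F j ∘ (suc x ∷_)) (suc m) a + ∑ (λ k j → sign (suc k) * g k j) m
      ≡⟨ cong (alternating (λ j → F j ∘ (suc x ∷_)) (suc m) a +_) (∑-sign-suc g m) ⟩
    alternating (λ j → F j ∘ (suc x ∷_)) (suc m) a - alternating (λ j → F j ∘ (x ∷_)) m a ∎
    where
    open ≡.≡-Reasoning
    f : ℕ → ℕ → ℚ
    f k j = eMul (suc k) (F j ∘ (suc x ∷_)) a
    g : ℕ → ℕ → ℚ
    g k j = eMul k (F j ∘ (x ∷_)) a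

  -- A series without constant term is t times another series, and the factor t passes through the
  -- multiplication by E(-t).
  alternating-shift : ∀ {F} m a → (∀ b → F 0 b ≡ 0ℚ) → alternating F (suc m) a ≡ alternating (F ∘ suc) m a
  alternating-shift {F} m a F0≡0 = begin
    alternating F (suc m) a
      ≡⟨ ∑-last (λ k j → sign k * eMul k (F j) a) m ⟩
    alternating (F ∘ suc) m a + sign (suc m) * eMul (suc m) (F 0) a
      ≡⟨ cong (λ z → alternating (F ∘ suc) m a + sign (suc m) * z) (eMul-zero (suc m) a F0≡0) ⟩
    alternating (F ∘ suc) m a + sign (suc m) * 0ℚ
      ≡⟨ cong (alternating (F ∘ suc) m a +_) (ℚ.*-zeroʳ (sign (suc m))) ⟩
    alternating (F ∘ suc) m a + 0ℚ
      ≡⟨ ℚ.+-identityʳ _ ⟩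
    alternating (F ∘ suc) m a ∎
    where open ≡.≡-Reasoning

  -- The symmetric function 1, so that `eMul n e₀` gives the coefficients of e_n.
  e₀ : List ℕ → ℚ
  e₀ = eCoeffℚ []

  eMul-e₀-1∷ : ∀ n a → eMul (suc n) e₀ (1 ∷ a) ≡ eMul n e₀ a
  eMul-e₀-1∷ n a = ≡.trans (cong (_+ eMul n e₀ a) (eMul-zero (suc n) {e₀ ∘ (1 ∷_)} a (λ _ → refl))) (ℚ.+-identityˡ _)

  eMul-e₀-2+∷ : ∀ n x a → eMul n e₀ (suc (suc x) ∷ a) ≡ 0ℚ
  eMul-e₀-2+∷ zero    x a = refl
  eMul-e₀-2+∷ (suc n) x a = cong₂ _+_ (eMul-zero (suc n) {e₀ ∘ (suc (suc x) ∷_)} a (λ _ → refl)) (eMul-zero n {e₀ ∘ (suc x ∷_)} a (λ _ → refl))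

  -- Coefficientwise form of E(-t) ∑ᵣ Pᵣ(t) y^r = E((y - 1) t), where Pᵣ(t) = ∑ₙ p_n^{(r)} t^n.
  alternating-pCoeffℚ : ∀ a r m → alternating (pCoeffℚ r) m a ≡ signedBinomial r m * eMul (r ℕ.+ m) e₀ a
  -- Induction on the number of variables. Each variable x contributes (1 - xt)(1 + y(xt + x²t² +
  -- ...)) = 1 + (y - 1)xt, and the cases of the head compare the coefficients of x^0, of x^1 and of
  -- the higher powers.
  alternating-pCoeffℚ [] zero    zero    = refl
  alternating-pCoeffℚ [] zero    (suc m) = ≡.trans
    (cong (1ℚ * 0ℚ +_) (∑-zero m (λ k j → ℚ.*-zeroʳ (sign (suc k)))))
    (≡.sym (ℚ.*-zeroʳ (signedBinomial 0 (suc m))))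
  alternating-pCoeffℚ [] (suc r) m       = ≡.trans
    (alternating-zero-[] m)
    (≡.sym (ℚ.*-zeroʳ (signedBinomial (suc r) m)))
    where
    alternating-zero-[] : ∀ m → alternating (pCoeffℚ (suc r)) m [] ≡ 0ℚ
    alternating-zero-[] m = ∑-zero m (λ { zero j → refl ; (suc k) j → ℚ.*-zeroʳ (sign (suc k)) })
  alternating-pCoeffℚ (zero ∷ a) r m = begin
    alternating (pCoeffℚ r) m (0 ∷ a)                        ≡⟨ alternating-0∷ (pCoeffℚ r) m a ⟩
    alternating (λ j → pCoeffℚ r j ∘ (0 ∷_)) m a             ≡⟨ ∑-cong m (λ k j _ → cong (sign k *_) (eMul-cong k a (λ _ → head0 r j _))) ⟩
    alternating (pCoeffℚ r) m a                              ≡⟨ alternating-pCoeffℚ a r m ⟩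
    signedBinomial r m * eMul (r ℕ.+ m) e₀ a                 ≡⟨ cong (signedBinomial r m *_) (eMul-0∷ (r ℕ.+ m) e₀ a) ⟨
    signedBinomial r m * eMul (r ℕ.+ m) e₀ (0 ∷ a)           ∎
    where
    open ≡.≡-Reasoning
    head0 : ∀ r j b → pCoeffℚ r j (0 ∷ b) ≡ pCoeffℚ r j b
    head0 zero    j b = refl
    head0 (suc r) j b = refl
  alternating-pCoeffℚ (suc zero ∷ a) zero    zero    = refl
  alternating-pCoeffℚ (suc zero ∷ a) zero    (suc m) = begin
    alternating (pCoeffℚ 0) (suc m) (1 ∷ a)
      ≡⟨ alternating-suc∷ (pCoeffℚ 0) m 0 a ⟩
    alternating (λ j → pCoeffℚ 0 j ∘ (1 ∷_)) (suc m) a - alternating (λ j → pCoeffℚ 0 j ∘ (0 ∷_)) m a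
      ≡⟨ cong₂ _-_ (alternating-zero {λ j → pCoeffℚ 0 j ∘ (1 ∷_)} (suc m) a (λ _ _ → refl)) (alternating-pCoeffℚ a 0 m) ⟩
    0ℚ - signedBinomial 0 m * eMul m e₀ a
      ≡⟨ ℚ.+-identityˡ _ ⟩
    - (signedBinomial 0 m * eMul m e₀ a)
      ≡⟨ ℚ.neg-distribˡ-* (signedBinomial 0 m) (eMul m e₀ a) ⟩
    signedBinomial 0 (suc m) * eMul m e₀ a
      ≡⟨ cong (signedBinomial 0 (suc m) *_) (eMul-e₀-1∷ m a) ⟨
    signedBinomial 0 (suc m) * eMul (suc m) e₀ (1 ∷ a) ∎
    where open ≡.≡-Reasoning
  alternating-pCoeffℚ (suc zero ∷ a) (suc r) zero    =
    ≡.trans (alternating-pCoeffℚ a r zero) (cong (signedBinomial r 0 *_) (≡.sym (eMul-e₀-1∷ (r ℕ.+ 0) a)))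
  alternating-pCoeffℚ (suc zero ∷ a) (suc r) (suc m) = begin
    alternating (pCoeffℚ (suc r)) (suc m) (1 ∷ a)
      ≡⟨ alternating-suc∷ (pCoeffℚ (suc r)) m 0 a ⟩
    alternating (pCoeffℚ r) (suc m) a - alternating (pCoeffℚ (suc r)) m a
      ≡⟨ cong₂ _-_ (alternating-pCoeffℚ a r (suc m)) (alternating-pCoeffℚ a (suc r) m) ⟩
    s * eMul (r ℕ.+ suc m) e₀ a - s′ * eMul (suc r ℕ.+ m) e₀ a
      ≡⟨ cong (λ n → s * eMul (r ℕ.+ suc m) e₀ a - s′ * eMul n e₀ a) (ℕ.+-suc r m) ⟨
    s * eMul (r ℕ.+ suc m) e₀ a - s′ * eMul (r ℕ.+ suc m) e₀ a
      ≡⟨ cong (s * eMul (r ℕ.+ suc m) e₀ a +_) (ℚ.neg-distribˡ-* s′ _) ⟩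
    s * eMul (r ℕ.+ suc m) e₀ a + - s′ * eMul (r ℕ.+ suc m) e₀ a
      ≡⟨ ℚ.*-distribʳ-+ (eMul (r ℕ.+ suc m) e₀ a) s (- s′) ⟨
    (s - s′) * eMul (r ℕ.+ suc m) e₀ a
      ≡⟨ cong ((s - s′) *_) (eMul-e₀-1∷ (r ℕ.+ suc m) a) ⟨
    (s - s′) * eMul (suc r ℕ.+ suc m) e₀ (1 ∷ a) ∎
    where
    open ≡.≡-Reasoning
    s = signedBinomial r (suc m)
    s′ = signedBinomial (suc r) m
  alternating-pCoeffℚ (suc (suc x) ∷ a) r m = ≡.trans (cancels r m)
    (≡.sym (≡.trans (cong (signedBinomial r m *_) (eMul-e₀-2+∷ (r ℕ.+ m) x a)) (ℚ.*-zeroʳ (signedBinomial r m))))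
    where
    cancels : ∀ r m → alternating (pCoeffℚ r) m (suc (suc x) ∷ a) ≡ 0ℚ
    cancels zero    zero    = refl
    cancels (suc r) zero    = refl
    cancels zero    (suc m) = ≡.trans (alternating-suc∷ (pCoeffℚ 0) m (suc x) a)
      (cong₂ _-_ (alternating-zero {λ j → pCoeffℚ 0 j ∘ (suc (suc x) ∷_)} (suc m) a (λ _ _ → refl))
                 (alternating-zero {λ j → pCoeffℚ 0 j ∘ (suc x ∷_)} m a (λ _ _ → refl)))
    -- Lowering the exponent and the excess together does not change `pCoeffℚ`, so after the shift
    -- the two terms agree and cancel.
    cancels (suc r) (suc m) = ≡.trans (alternating-suc∷ (pCoeffℚ (suc r)) m (suc x) a)
      (≡.trans (cong (_- alternating (λ j → pCoeffℚ (suc r) j ∘ (suc x ∷_)) m a)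
                     (alternating-shift {λ j → pCoeffℚ (suc r) j ∘ (suc (suc x) ∷_)} m a (λ _ → refl)))
               (ℚ.+-inverseʳ (alternating (λ j → pCoeffℚ (suc r) j ∘ (suc x ∷_)) m a)))

  antidiagonalConcat : (ℕ → ℕ → EExpr) → ℕ → EExpr
  antidiagonalConcat F zero    = F 0 0
  antidiagonalConcat F (suc n) = F 0 (suc n) ++ antidiagonalConcat (λ k → F (suc k)) n

  lin-antidiagonalConcat : ∀ F n G → lin (antidiagonalConcat F n) G ≡ ∑ (λ k j → lin (F k j) G) n
  lin-antidiagonalConcat F zero    G = refl
  lin-antidiagonalConcat F (suc n) G =
    ≡.trans (lin-++ (F 0 (suc n)) _ G) (cong (lin (F 0 (suc n)) G +_) (lin-antidiagonalConcat (λ k → F (suc k)) n G))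

  -- e-expansion of p_{r+m}^{(r)} obtained by solving alternating-pCoeffℚ for its k = 0 term;
  -- the first argument, which has to exceed m, bounds the recursion depth
  pExpr : ℕ → ℕ → ℕ → EExpr
  pExpr zero    r m       = []
  pExpr (suc L) r zero    = (signedBinomial r 0 , r ℕ.+ 0 ∷ []) ∷ []
  pExpr (suc L) r (suc m) =
    (signedBinomial r (suc m) , r ℕ.+ suc m ∷ []) ∷
    antidiagonalConcat (λ k j → mulTerm (sign k) (suc k) (pExpr L r j)) m

  lin-eMul : ∀ k E a → lin E (λ μ → eMul k (eCoeffℚ μ) a) ≡ eMul k (λ b → lin E (λ μ → eCoeffℚ μ b)) a
  lin-eMul k []            a = ≡.sym (eMul-zero k {λ _ → 0ℚ} a (λ _ → refl))
  lin-eMul k ((c , μ) ∷ E) a = begin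
    c * eMul k (eCoeffℚ μ) a + lin E (λ μ → eMul k (eCoeffℚ μ) a)
      ≡⟨ cong₂ _+_ (≡.sym (eMul-*ˡ k c (eCoeffℚ μ) a)) (lin-eMul k E a) ⟩
    eMul k (λ b → c * eCoeffℚ μ b) a + eMul k (λ b → lin E (λ μ → eCoeffℚ μ b)) a
      ≡⟨ eMul-+ k (λ b → c * eCoeffℚ μ b) (λ b → lin E (λ μ → eCoeffℚ μ b)) a ⟨
    eMul k (λ b → c * eCoeffℚ μ b + lin E (λ μ → eCoeffℚ μ b)) a ∎
    where open ≡.≡-Reasoning

  lin-pExpr : ∀ L r m → m ℕ.< L → ∀ a → lin (pExpr L r m) (λ μ → eCoeffℚ μ a) ≡ pCoeffℚ r m a
  lin-pExpr (suc L) r zero    _         a = begin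
    signedBinomial r 0 * eCoeffℚ (r ℕ.+ 0 ∷ []) a + 0ℚ   ≡⟨ ℚ.+-identityʳ _ ⟩
    signedBinomial r 0 * eCoeffℚ (r ℕ.+ 0 ∷ []) a        ≡⟨ cong (signedBinomial r 0 *_) (eCoeffℚ-∷ (r ℕ.+ 0) [] a) ⟩
    signedBinomial r 0 * eMul (r ℕ.+ 0) e₀ a             ≡⟨ alternating-pCoeffℚ a r 0 ⟨
    1ℚ * pCoeffℚ r 0 a                                   ≡⟨ ℚ.*-identityˡ _ ⟩
    pCoeffℚ r 0 a                                        ∎
    where open ≡.≡-Reasoning
  lin-pExpr (suc L) r (suc m) (s≤s m<L) a = begin
    signedBinomial r (suc m) * eCoeffℚ (r ℕ.+ suc m ∷ []) a +
      lin (antidiagonalConcat (λ k j → mulTerm (sign k) (suc k) (pExpr L r j)) m) (λ μ → eCoeffℚ μ a)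
      ≡⟨ cong₂ _+_ (cong (signedBinomial r (suc m) *_) (eCoeffℚ-∷ (r ℕ.+ suc m) [] a))
                   (≡.trans (lin-antidiagonalConcat _ m _) (∑-cong m term)) ⟩
    signedBinomial r (suc m) * eMul (r ℕ.+ suc m) e₀ a + S
      ≡⟨ cong (_+ S) (alternating-pCoeffℚ a r (suc m)) ⟨
    1ℚ * pCoeffℚ r (suc m) a + ∑ (λ k j → sign (suc k) * eMul (suc k) (pCoeffℚ r j) a) m + S
      ≡⟨ cong (λ z → 1ℚ * pCoeffℚ r (suc m) a + z + S) (∑-sign-suc (λ k j → eMul (suc k) (pCoeffℚ r j) a) m) ⟩
    1ℚ * pCoeffℚ r (suc m) a + - S + S
      ≡⟨ ℚ.+-assoc (1ℚ * pCoeffℚ r (suc m) a) (- S) S ⟩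
    1ℚ * pCoeffℚ r (suc m) a + (- S + S)
      ≡⟨ cong₂ _+_ (ℚ.*-identityˡ (pCoeffℚ r (suc m) a)) (ℚ.+-inverseˡ S) ⟩
    pCoeffℚ r (suc m) a + 0ℚ
      ≡⟨ ℚ.+-identityʳ _ ⟩
    pCoeffℚ r (suc m) a ∎
    where
    open ≡.≡-Reasoning
    S = ∑ (λ k j → sign k * eMul (suc k) (pCoeffℚ r j) a) m
    term : ∀ k j → k ℕ.+ j ≡ m →
           lin (mulTerm (sign k) (suc k) (pExpr L r j)) (λ μ → eCoeffℚ μ a) ≡ sign k * eMul (suc k) (pCoeffℚ r j) a
    term k j eq = begin
      lin (mulTerm (sign k) (suc k) (pExpr L r j)) (λ μ → eCoeffℚ μ a)
        ≡⟨ lin-mulTerm (sign k) (suc k) (pExpr L r j) _ ⟩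
      sign k * lin (pExpr L r j) (λ μ → eCoeffℚ (suc k ∷ μ) a)
        ≡⟨ cong (sign k *_) (lin-ext (pExpr L r j) (λ μ → eCoeffℚ-∷ (suc k) μ a)) ⟩
      sign k * lin (pExpr L r j) (λ μ → eMul (suc k) (eCoeffℚ μ) a)
        ≡⟨ cong (sign k *_) (lin-eMul (suc k) (pExpr L r j) a) ⟩
      sign k * eMul (suc k) (λ b → lin (pExpr L r j) (λ μ → eCoeffℚ μ b)) a
        ≡⟨ cong (sign k *_) (eMul-cong (suc k) a (lin-pExpr L r j (ℕ.≤-<-trans (subst (j ℕ.≤_) eq (ℕ.m≤n+m j k)) m<L))) ⟩
      sign k * eMul (suc k) (pCoeffℚ r j) a ∎

open SymmetricFunctions

-- The coefficients of E(-q^r t)/E(-t).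

module Deformation {c ℓ} (R : CommutativeRing c ℓ) where

  open CommutativeRing R renaming (refl to ≈-refl; sym to ≈-sym; trans to ≈-trans)

  -- Of ℚ[q] only the ring laws, the embedding of ℚ and the recursion for [r]_q enter. Working over
  -- an abstract ring keeps coefficient lists out of the algebra.
  module Specialisation
    (ι : ℚ → Carrier)
    (ι-homo : RingMorphisms.IsRingHomomorphism ℚ.+-*-rawRing rawRing ι)
    (q : Carrier) (qnum : ℕ → Carrier)
    (qnum-zero : qnum 0 ≈ 0#)
    (qnum-suc : ∀ r → qnum (suc r) ≈ 1# + q * qnum r)
    where

    open RingMorphisms.IsRingHomomorphism ι-homo using (⟦⟧-cong)
      renaming (+-homo to ι-+; *-homo to ι-*; 1#-homo to ι-1; 0#-homo to ι-0; -‿homo to ι-neg)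
    open Exp semiring
    open import Algebra.Properties.CommutativeSemiring.Exp commutativeSemiring using (^-distrib-*)
    open import Algebra.Properties.Ring ring using (-‿distribʳ-*; -1*x≈-x)
    open import Relation.Binary.Reasoning.Setoid setoid
    open import Algebra.Solver.Ring.NaturalCoefficients.Default commutativeSemiring
      using (solve; _:=_; _:+_; _:*_)
    open Antidiagonal R
    open ListSum R

    comm3 : ∀ x y z → x * (y * z) ≈ y * (x * z)
    comm3 = solve 3 (λ x y z → x :* (y :* z) := y :* (x :* z)) ≈-refl

    [1-q]*qnum : ∀ r → (1# + - q) * qnum r ≈ 1# + - (q ^ r)
    [1-q]*qnum zero    = ≈-trans (*-congˡ qnum-zero) (≈-trans (zeroʳ _) (≈-sym (-‿inverseʳ 1#)))
    [1-q]*qnum (suc r) = begin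
      (1# + - q) * qnum (suc r)                         ≈⟨ *-congˡ (qnum-suc r) ⟩
      (1# + - q) * (1# + q * qnum r)                    ≈⟨ distribˡ _ _ _ ⟩
      (1# + - q) * 1# + (1# + - q) * (q * qnum r)       ≈⟨ +-cong (*-identityʳ _) (comm3 _ _ _) ⟩
      (1# + - q) + q * ((1# + - q) * qnum r)            ≈⟨ +-congˡ (*-congˡ ([1-q]*qnum r)) ⟩
      (1# + - q) + q * (1# + - (q ^ r))                 ≈⟨ +-congˡ (distribˡ _ _ _) ⟩
      (1# + - q) + (q * 1# + q * - (q ^ r))             ≈⟨ +-congˡ (+-cong (*-identityʳ q) (≈-sym (-‿distribʳ-* q (q ^ r)))) ⟩
      (1# + - q) + (q + - (q ^ suc r))                  ≈⟨ rearrange _ _ _ _ ⟩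
      1# + - (q ^ suc r) + (- q + q)                    ≈⟨ +-congˡ (-‿inverseˡ q) ⟩
      1# + - (q ^ suc r) + 0#                           ≈⟨ +-identityʳ _ ⟩
      1# + - (q ^ suc r)                                ∎
      where
      rearrange : ∀ a b c d → (a + b) + (c + d) ≈ a + d + (b + c)
      rearrange = solve 4 (λ a b c d → (a :+ b) :+ (c :+ d) := a :+ d :+ (b :+ c)) ≈-refl

    inv! : ℕ → Carrier
    inv! n = ι (invFact n)

    nat : ℕ → Carrier
    nat n = ι (fromℕ n)

    φₑ : ℕ → Carrier
    φₑ k = inv! k * q ^ (k C 2)

    sgn : ℕ → Carrier
    sgn k = (- 1#) ^ k

    nat-suc*inv!-suc : ∀ n → nat (suc n) * inv! (suc n) ≈ inv! n
    nat-suc*inv!-suc n = ≈-trans (≈-sym (ι-* _ _)) (⟦⟧-cong (fromℕ-suc*invFact-suc n))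

    -- R need not be a field, but n! · 1/(n+1)! is the inverse of n + 1 and lies in the image of ℚ.
    nat-suc-cancel : ∀ n x y → nat (suc n) * x ≈ nat (suc n) * y → x ≈ y
    nat-suc-cancel n x y eq = begin
      x                                                          ≈⟨ lemma x ⟨
      (nat (n !) * inv! (suc n)) * (nat (suc n) * x)             ≈⟨ *-congˡ eq ⟩
      (nat (n !) * inv! (suc n)) * (nat (suc n) * y)             ≈⟨ lemma y ⟩
      y                                                          ∎
      where
      lemma : ∀ z → (nat (n !) * inv! (suc n)) * (nat (suc n) * z) ≈ z
      lemma z = begin
        (nat (n !) * inv! (suc n)) * (nat (suc n) * z)   ≈⟨ rearrange _ _ _ _ ⟩
        nat (n !) * (nat (suc n) * inv! (suc n)) * z     ≈⟨ *-congʳ (*-congˡ (nat-suc*inv!-suc n)) ⟩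
        nat (n !) * inv! n * z                           ≈⟨ *-congʳ (≈-sym (ι-* _ _)) ⟩
        ι (fromℕ (n !) ℚ.* invFact n) * z                ≈⟨ *-congʳ (≈-trans (⟦⟧-cong (fromℕ!*invFact n)) ι-1) ⟩
        1# * z                                           ≈⟨ *-identityˡ z ⟩
        z                                                ∎
        where
        rearrange : ∀ a b c d → (a * b) * (c * d) ≈ a * (c * b) * d
        rearrange = solve 4 (λ a b c d → (a :* b) :* (c :* d) := a :* (c :* b) :* d) ≈-refl

    nat-+ : ∀ m n → nat (m ℕ.+ n) ≈ nat m + nat n
    nat-+ m n = ≈-trans (⟦⟧-cong (fromℕ-+ m n)) (ι-+ _ _)

    dividedPower : Carrier → ℕ → Carrier
    dividedPower a u = a ^ u * inv! u

    nat-suc*dividedPower-suc : ∀ a u → nat (suc u) * dividedPower a (suc u) ≈ a * dividedPower a u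
    nat-suc*dividedPower-suc a u = begin
      nat (suc u) * ((a * a ^ u) * inv! (suc u))   ≈⟨ rearrange _ _ _ _ ⟩
      a * (a ^ u * (nat (suc u) * inv! (suc u)))   ≈⟨ *-congˡ (*-congˡ (nat-suc*inv!-suc u)) ⟩
      a * (a ^ u * inv! u)                         ∎
      where
      rearrange : ∀ n a p i → n * ((a * p) * i) ≈ a * (p * (n * i))
      rearrange = solve 4 (λ n a p i → n :* ((a :* p) :* i) := a :* (p :* (n :* i))) ≈-refl

    -- The coefficients of exp(at) exp(bt) = exp((a+b)t). Multiplying the coefficient of t^{m+1} by
    -- m + 1 = u + w is differentiation, and Leibniz's rule reduces the claim to m.
    binomial : ∀ a b m → ∑ (λ u w → dividedPower a u * dividedPower b w) m ≈ dividedPower (a + b) m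
    binomial a b zero = begin
      (1# * inv! 0) * (1# * inv! 0)   ≈⟨ *-cong one one ⟩
      1# * 1#                         ≈⟨ *-identityˡ 1# ⟩
      1#                              ≈⟨ one ⟨
      1# * inv! 0                     ∎
      where
      one : 1# * inv! 0 ≈ 1#
      one = ≈-trans (*-identityˡ _) ι-1
    binomial a b (suc m) = nat-suc-cancel m _ _ (begin
      nat (suc m) * ∑ (λ u w → D a u * D b w) (suc m)
        ≈⟨ ≈-sym (∑-*ˡ _ (λ u w → D a u * D b w) (suc m)) ⟩
      ∑ (λ u w → nat (suc m) * (D a u * D b w)) (suc m)
        ≈⟨ ∑-cong (suc m) term ⟩
      ∑ (λ u w → (nat u * D a u) * D b w + D a u * (nat w * D b w)) (suc m)
        ≈⟨ ∑-+ (λ u w → (nat u * D a u) * D b w) (λ u w → D a u * (nat w * D b w)) (suc m) ⟩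
      ∑ (λ u w → (nat u * D a u) * D b w) (suc m) + ∑ (λ u w → D a u * (nat w * D b w)) (suc m)
        ≈⟨ +-cong left right ⟩
      a * ∑ (λ u w → D a u * D b w) m + b * ∑ (λ u w → D a u * D b w) m
        ≈⟨ ≈-sym (distribʳ _ a b) ⟩
      (a + b) * ∑ (λ u w → D a u * D b w) m
        ≈⟨ *-congˡ (binomial a b m) ⟩
      (a + b) * D (a + b) m
        ≈⟨ nat-suc*dividedPower-suc (a + b) m ⟨
      nat (suc m) * D (a + b) (suc m) ∎)
      where
      D = dividedPower
      leibniz : ∀ n n′ x y → (n + n′) * (x * y) ≈ (n * x) * y + x * (n′ * y)
      leibniz = solve 4 (λ n n′ x y → (n :+ n′) :* (x :* y) := (n :* x) :* y :+ x :* (n′ :* y)) ≈-refl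
      term : ∀ u w → u ℕ.+ w ≡ suc m → nat (suc m) * (D a u * D b w) ≈ (nat u * D a u) * D b w + D a u * (nat w * D b w)
      term u w eq = ≈-trans (*-congʳ (≈-trans (⟦⟧-cong (cong fromℕ (≡.sym eq))) (nat-+ u w))) (leibniz _ _ _ _)
      nat0* : ∀ x → nat 0 * x ≈ 0#
      nat0* x = ≈-trans (*-congʳ ι-0) (zeroˡ x)
      left : ∑ (λ u w → (nat u * D a u) * D b w) (suc m) ≈ a * ∑ (λ u w → D a u * D b w) m
      left = begin
        (nat 0 * D a 0) * D b (suc m) + ∑ (λ u w → (nat (suc u) * D a (suc u)) * D b w) m
          ≈⟨ +-cong (≈-trans (*-congʳ (nat0* _)) (zeroˡ _))
                    (∑-cong m (λ u w _ → ≈-trans (*-congʳ (nat-suc*dividedPower-suc a u)) (*-assoc _ _ _))) ⟩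
        0# + ∑ (λ u w → a * (D a u * D b w)) m       ≈⟨ +-identityˡ _ ⟩
        ∑ (λ u w → a * (D a u * D b w)) m            ≈⟨ ∑-*ˡ a _ m ⟩
        a * ∑ (λ u w → D a u * D b w) m              ∎
      right : ∑ (λ u w → D a u * (nat w * D b w)) (suc m) ≈ b * ∑ (λ u w → D a u * D b w) m
      right = begin
        ∑ (λ u w → D a u * (nat w * D b w)) (suc m)  ≈⟨ ∑-last (λ u w → D a u * (nat w * D b w)) m ⟩
        ∑ (λ u w → D a u * (nat (suc w) * D b (suc w))) m + D a (suc m) * (nat 0 * D b 0)
          ≈⟨ +-cong (∑-cong m (λ u w _ → ≈-trans (*-congˡ (nat-suc*dividedPower-suc b w)) (comm3 _ _ _)))
                    (≈-trans (*-congˡ (nat0* _)) (zeroʳ _)) ⟩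
        ∑ (λ u w → b * (D a u * D b w)) m + 0#       ≈⟨ +-identityʳ _ ⟩
        ∑ (λ u w → b * (D a u * D b w)) m            ≈⟨ ∑-*ˡ b _ m ⟩
        b * ∑ (λ u w → D a u * D b w) m              ∎
  
    -- On the right the power of q depends on u + w only. It can thus be taken out of a sum over u +
    -- w = m, where a convolution of divided powers remains.
    φₑ-*-φₑ : ∀ u w → φₑ u * φₑ w * q ^ (u ℕ.* w) ≈ (inv! u * inv! w) * q ^ ((u ℕ.+ w) C 2)
    φₑ-*-φₑ u w = begin
      (inv! u * q ^ (u C 2)) * (inv! w * q ^ (w C 2)) * q ^ (u ℕ.* w)
        ≈⟨ rearrange _ _ _ _ _ ⟩
      (inv! u * inv! w) * (q ^ (u C 2) * q ^ (w C 2) * q ^ (u ℕ.* w))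
        ≈⟨ *-congˡ (≈-trans (*-congʳ (≈-sym (^-homo-* q (u C 2) (w C 2)))) (≈-sym (^-homo-* q (u C 2 ℕ.+ w C 2) (u ℕ.* w)))) ⟩
      (inv! u * inv! w) * q ^ (u C 2 ℕ.+ w C 2 ℕ.+ u ℕ.* w)
        ≈⟨ *-congˡ (^-congʳ q (≡.sym (C2-+ u w))) ⟩
      (inv! u * inv! w) * q ^ ((u ℕ.+ w) C 2) ∎
      where
      rearrange : ∀ a b c d e → (a * b) * (c * d) * e ≈ (a * c) * (b * d * e)
      rearrange = solve 5 (λ a b c d e → (a :* b) :* (c :* d) :* e := (a :* c) :* (b :* d :* e)) ≈-refl

    δ : ℕ → Carrier
    δ zero    = 1#
    δ (suc _) = 0#

    -- What an entry u contributes when the entry before it is r; for the first entry, r is the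
    -- given number of parts.
    weight : ℕ → ℕ → Carrier
    weight r u = qnum r ^ u * φₑ u

    -- m! J is J_{r+m}^{(r)} restricted to sequences supported in positions 1..L
    J : ℕ → ℕ → ℕ → Carrier
    J zero    r m = δ m
    J (suc L) r m = ∑ (λ u v → weight r u * J L u v) m

    φₑ-zero : φₑ 0 ≈ 1#
    φₑ-zero = ≈-trans (*-identityʳ _) ι-1

    weight-zero : ∀ r → weight r 0 ≈ 1#
    weight-zero r = ≈-trans (*-identityˡ _) φₑ-zero

    weight-0-suc : ∀ u → weight 0 (suc u) ≈ 0#
    weight-0-suc u = ≈-trans (*-congʳ (≈-trans (*-congʳ qnum-zero) (zeroˡ _))) (zeroˡ _)

    -- Here [0]_q^u = 0 for u > 0 while [0]_q^0 = 1: after an entry 0, only the zero sequence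
    -- contributes.
    J-zero : ∀ L m → J L 0 m ≈ δ m
    J-zero zero    m       = ≈-refl
    J-zero (suc L) zero    = ≈-trans (*-cong (weight-zero 0) (J-zero L 0)) (*-identityˡ _)
    J-zero (suc L) (suc m) = begin
      weight 0 0 * J L 0 (suc m) + ∑ (λ u v → weight 0 (suc u) * J L (suc u) v) m
        ≈⟨ +-cong (≈-trans (*-congˡ (J-zero L (suc m))) (zeroʳ _))
                  (∑-zero m (λ u v → ≈-trans (*-congʳ (weight-0-suc u)) (zeroˡ _))) ⟩
      0# + 0#   ≈⟨ +-identityˡ 0# ⟩
      0#        ∎

    K : ℕ → ℕ → ℕ → Carrier
    K L r m = (1# + - q) ^ m * J L r m

    -- The exponents of the q-integers along a sequence add up to m, so the m factors 1 - q can be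
    -- shared out: u of them turn [r]_q^u into (1 - q^r)^u, and the others go to the remaining
    -- entries.
    K-suc : ∀ L r m → K (suc L) r m ≈ ∑ (λ u v → ((1# + - (q ^ r)) ^ u * φₑ u) * K L u v) m
    K-suc L r m = begin
      (1# + - q) ^ m * ∑ (λ u v → weight r u * J L u v) m       ≈⟨ ≈-sym (∑-*ˡ _ _ m) ⟩
      ∑ (λ u v → (1# + - q) ^ m * (weight r u * J L u v)) m     ≈⟨ ∑-cong m (λ { u v refl → term u v }) ⟩
      ∑ (λ u v → ((1# + - (q ^ r)) ^ u * φₑ u) * K L u v) m     ∎
      where
      rearrange : ∀ p p′ x e j → (p * p′) * ((x * e) * j) ≈ ((p * x) * e) * (p′ * j)
      rearrange = solve 5 (λ p p′ x e j → (p :* p′) :* ((x :* e) :* j) := ((p :* x) :* e) :* (p′ :* j)) ≈-refl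
      term : ∀ u v → (1# + - q) ^ (u ℕ.+ v) * (weight r u * J L u v) ≈ ((1# + - (q ^ r)) ^ u * φₑ u) * K L u v
      term u v = begin
        (1# + - q) ^ (u ℕ.+ v) * (weight r u * J L u v)
          ≈⟨ *-congʳ (^-homo-* _ u v) ⟩
        ((1# + - q) ^ u * (1# + - q) ^ v) * ((qnum r ^ u * φₑ u) * J L u v)
          ≈⟨ rearrange _ _ _ _ _ ⟩
        (((1# + - q) ^ u * qnum r ^ u) * φₑ u) * K L u v
          ≈⟨ *-congʳ (*-congʳ (≈-trans (≈-sym (^-distrib-* _ _ u)) (^-congˡ u ([1-q]*qnum r)))) ⟩
        ((1# + - (q ^ r)) ^ u * φₑ u) * K L u v ∎

    K-zero : ∀ L m → K L 0 m ≈ δ m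
    K-zero L zero    = ≈-trans (*-identityˡ _) (J-zero L 0)
    K-zero L (suc m) = ≈-trans (*-congˡ (J-zero L (suc m))) (zeroʳ _)

    ∑-δʳ : ∀ f m → ∑ (λ k j → f k * δ j) m ≈ f m
    ∑-δʳ f zero    = *-identityʳ _
    ∑-δʳ f (suc m) = ≈-trans (+-cong (zeroʳ _) (∑-δʳ (λ k → f (suc k)) m)) (+-identityˡ _)

    -- Coefficientwise form of E(-t) H_r(t) = E(-q^r t), where E(t) = ∑ φₑ n t^n and H_r has
    -- coefficients K L r: as E' (t) = E (q t), Taylor's formula expands E(-q^r t) around -t.
    E*K : ∀ L m r → m ℕ.≤ L → ∑ (λ k j → (sgn k * φₑ k) * K L r j) m ≈ sgn m * q ^ (r ℕ.* m) * φₑ m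
    E*K zero zero r z≤n = begin
      (1# * φₑ 0) * (1# * 1#)             ≈⟨ ≈-trans (*-congˡ (*-identityˡ _)) (*-identityʳ _) ⟩
      1# * φₑ 0                           ≈⟨ *-congʳ (≈-trans (*-identityˡ _) (^-congʳ q (ℕ.*-zeroʳ r))) ⟨
      1# * q ^ (r ℕ.* 0) * φₑ 0           ∎
    E*K (suc L) m r m≤1+L = begin
      ∑ (λ k j → (sgn k * φₑ k) * K (suc L) r j) m
        ≈⟨ ∑-cong m (λ k j _ → ≈-trans (*-congˡ (K-suc L r j)) (≈-sym (∑-*ˡ _ _ j))) ⟩
      ∑ (λ k j → ∑ (λ u v → (sgn k * φₑ k) * (α u * K L u v)) j) m
        ≈⟨ ∑-swap (λ k u v → (sgn k * φₑ k) * (α u * K L u v)) m ⟩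
      ∑ (λ u w → ∑ (λ k v → (sgn k * φₑ k) * (α u * K L u v)) w) m
        ≈⟨ ∑-cong m (λ u w eq → ≈-trans (∑-cong w (λ k v _ → comm3 _ _ _)) (≈-trans (∑-*ˡ _ _ w) (*-congˡ (inner u w eq)))) ⟩
      ∑ (λ u w → α u * (sgn w * q ^ (u ℕ.* w) * φₑ w)) m
        ≈⟨ ∑-cong m (λ { u w refl → term u w }) ⟩
      ∑ (λ u w → q ^ (m C 2) * (dividedPower a u * dividedPower (- 1#) w)) m
        ≈⟨ ∑-*ˡ _ _ m ⟩
      q ^ (m C 2) * ∑ (λ u w → dividedPower a u * dividedPower (- 1#) w) m
        ≈⟨ *-congˡ (binomial a (- 1#) m) ⟩
      q ^ (m C 2) * ((a + - 1#) ^ m * inv! m)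
        ≈⟨ *-congˡ (*-congʳ (≈-trans (^-congˡ m a-1) (≈-trans (^-distrib-* _ _ m) (*-congˡ (^-assocʳ q r m))))) ⟩
      q ^ (m C 2) * ((sgn m * q ^ (r ℕ.* m)) * inv! m)
        ≈⟨ rearrange′ _ _ _ ⟩
      sgn m * q ^ (r ℕ.* m) * φₑ m ∎
      where
      -- The increment of the Taylor expansion: -t + a t = -q^r t.
      a = 1# + - (q ^ r)
      α : ℕ → Carrier
      α u = a ^ u * φₑ u
      rearrange′ : ∀ x y z → x * (y * z) ≈ y * (z * x)
      rearrange′ = solve 3 (λ x y z → x :* (y :* z) := y :* (z :* x)) ≈-refl
      a-1 : a + - 1# ≈ (- 1#) * q ^ r
      a-1 = begin
        (1# + - (q ^ r)) + - 1#   ≈⟨ +-congʳ (+-comm _ _) ⟩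
        (- (q ^ r) + 1#) + - 1#   ≈⟨ +-assoc _ _ _ ⟩
        - (q ^ r) + (1# + - 1#)   ≈⟨ +-congˡ (-‿inverseʳ 1#) ⟩
        - (q ^ r) + 0#            ≈⟨ +-identityʳ _ ⟩
        - (q ^ r)                 ≈⟨ -1*x≈-x _ ⟨
        (- 1#) * q ^ r            ∎
      -- For u = 0 the rest w may be L + 1, out of reach of the induction hypothesis; there the
      -- predecessor 0 reduces K to δ. For a positive first entry, w ≤ L.
      inner : ∀ u w → u ℕ.+ w ≡ m → ∑ (λ k v → (sgn k * φₑ k) * K L u v) w ≈ sgn w * q ^ (u ℕ.* w) * φₑ w
      inner zero    w _  = begin
        ∑ (λ k v → (sgn k * φₑ k) * K L 0 v) w   ≈⟨ ∑-cong w (λ k v _ → *-congˡ (K-zero L v)) ⟩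
        ∑ (λ k v → (sgn k * φₑ k) * δ v) w       ≈⟨ ∑-δʳ _ w ⟩
        sgn w * φₑ w                             ≈⟨ *-congʳ (*-identityʳ _) ⟨
        sgn w * 1# * φₑ w                        ∎
      inner (suc u) w eq = E*K L w (suc u) (ℕ.≤-pred (ℕ.≤-trans (s≤s (ℕ.m≤n+m w u)) (subst (ℕ._≤ suc L) (≡.sym eq) m≤1+L)))
      term : ∀ u w → α u * (sgn w * q ^ (u ℕ.* w) * φₑ w) ≈ q ^ ((u ℕ.+ w) C 2) * (dividedPower a u * dividedPower (- 1#) w)
      term u w = begin
        (a ^ u * φₑ u) * (sgn w * q ^ (u ℕ.* w) * φₑ w)
          ≈⟨ solve 5 (λ x e s p f → (x :* e) :* (s :* p :* f) := (x :* s) :* (e :* f :* p)) ≈-refl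
               (a ^ u) (φₑ u) (sgn w) (q ^ (u ℕ.* w)) (φₑ w) ⟩
        (a ^ u * sgn w) * (φₑ u * φₑ w * q ^ (u ℕ.* w))
          ≈⟨ *-congˡ (φₑ-*-φₑ u w) ⟩
        (a ^ u * sgn w) * ((inv! u * inv! w) * q ^ ((u ℕ.+ w) C 2))
          ≈⟨ solve 5 (λ x s i j p → (x :* s) :* ((i :* j) :* p) := p :* ((x :* i) :* (s :* j))) ≈-refl
               (a ^ u) (sgn w) (inv! u) (inv! w) _ ⟩
        q ^ ((u ℕ.+ w) C 2) * (dividedPower a u * dividedPower (- 1#) w) ∎

    -- `signedBinomial r m` is (-1)^m (r+m)!/(r! m!). The induction multiplies Pascal's rule by
    -- (r+1) + (m+1), each summand cancelling against one of the two factorials.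
    signedBinomial*inv! : ∀ r m → ι (signedBinomial r m) * inv! (r ℕ.+ m) ≈ sgn m * (inv! r * inv! m)
    signedBinomial*inv! zero zero = *-cong ι-1 (≈-sym (≈-trans (*-congʳ ι-1) (*-identityˡ _)))
    signedBinomial*inv! zero (suc m) = *-cong (ι-signed (suc m)) (≈-sym (≈-trans (*-congʳ ι-1) (*-identityˡ _)))
      where
      ι-signed : ∀ m → ι (signedBinomial 0 m) ≈ sgn m
      ι-signed zero    = ι-1
      ι-signed (suc m) = ≈-trans (ι-neg _) (≈-trans (-‿cong (ι-signed m)) (≈-sym (-1*x≈-x _)))
    signedBinomial*inv! (suc r) zero = begin
      ι (signedBinomial (suc r) 0) * inv! (suc r ℕ.+ 0)   ≈⟨ *-cong (≈-trans (⟦⟧-cong (s≡1 (suc r))) ι-1)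
                                                                   (⟦⟧-cong (cong invFact (ℕ.+-identityʳ (suc r)))) ⟩
      1# * inv! (suc r)                                   ≈⟨ *-congˡ (≈-trans (*-congˡ ι-1) (*-identityʳ _)) ⟨
      1# * (inv! (suc r) * inv! 0)                        ∎
      where
      s≡1 : ∀ r → signedBinomial r 0 ≡ 1ℚ
      s≡1 zero    = refl
      s≡1 (suc r) = s≡1 r
    signedBinomial*inv! (suc r) (suc m) = nat-suc-cancel (r ℕ.+ suc m) _ _ (begin
      N * (ι (s ℚ.- s′) * inv! (suc (r ℕ.+ suc m)))
        ≈⟨ comm3 _ _ _ ⟩
      ι (s ℚ.- s′) * (N * inv! (suc (r ℕ.+ suc m)))
        ≈⟨ *-cong (≈-trans (ι-+ _ _) (+-congˡ (≈-trans (ι-neg _) (≈-sym (-1*x≈-x _))))) (nat-suc*inv!-suc (r ℕ.+ suc m)) ⟩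
      (ι s + (- 1#) * ι s′) * inv! (r ℕ.+ suc m)
        ≈⟨ expand _ _ _ _ ⟩
      ι s * inv! (r ℕ.+ suc m) + (- 1#) * (ι s′ * inv! (r ℕ.+ suc m))
        ≈⟨ +-cong (signedBinomial*inv! r (suc m))
                  (*-congˡ (≈-trans (*-congˡ (⟦⟧-cong (cong invFact (ℕ.+-suc r m)))) (signedBinomial*inv! (suc r) m))) ⟩
      (- 1# * sgn m) * (inv! r * inv! (suc m)) + (- 1#) * (sgn m * (inv! (suc r) * inv! m))
        ≈⟨ +-cong (*-congˡ (*-congʳ (≈-sym (nat-suc*inv!-suc r)))) (*-congˡ (*-congˡ (*-congˡ (≈-sym (nat-suc*inv!-suc m))))) ⟩
      (- 1# * sgn m) * ((nat (suc r) * inv! (suc r)) * inv! (suc m)) + (- 1#) * (sgn m * (inv! (suc r) * (nat (suc m) * inv! (suc m))))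
        ≈⟨ collect _ _ _ _ _ _ ⟩
      (nat (suc r) + nat (suc m)) * ((- 1# * sgn m) * (inv! (suc r) * inv! (suc m)))
        ≈⟨ *-congʳ (≈-sym (nat-+ (suc r) (suc m))) ⟩
      N * (sgn (suc m) * (inv! (suc r) * inv! (suc m))) ∎)
      where
      N = nat (suc (r ℕ.+ suc m))
      s = signedBinomial r (suc m)
      s′ = signedBinomial (suc r) m
      expand : ∀ a n b i → (a + n * b) * i ≈ a * i + n * (b * i)
      expand = solve 4 (λ a n b i → (a :+ n :* b) :* i := a :* i :+ n :* (b :* i)) ≈-refl
      collect : ∀ n g a b i j → (n * g) * ((a * i) * j) + n * (g * (i * (b * j))) ≈ (a + b) * ((n * g) * (i * j))
      collect = solve 6 (λ n g a b i j → (n :* g) :* ((a :* i) :* j) :+ n :* (g :* (i :* (b :* j)))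
                                       := (a :+ b) :* ((n :* g) :* (i :* j))) ≈-refl

    -- This is `alternating-pCoeffℚ` with e_k replaced by φ(e_k) and p_{r+j}^{(r)} by its expected
    -- image. Since the coefficient for k = 0 is 1, such a system has only one solution.
    E*[φ-K] : ∀ L r m → m ℕ.≤ L →
              ∑ (λ k j → (sgn k * φₑ k) * (φₑ r * K L r j)) m ≈ ι (signedBinomial r m) * φₑ (r ℕ.+ m)
    E*[φ-K] L r m m≤L = begin
      ∑ (λ k j → (sgn k * φₑ k) * (φₑ r * K L r j)) m
        ≈⟨ ∑-cong m (λ k j _ → comm3 _ _ _) ⟩
      ∑ (λ k j → φₑ r * ((sgn k * φₑ k) * K L r j)) m
        ≈⟨ ∑-*ˡ _ _ m ⟩
      φₑ r * ∑ (λ k j → (sgn k * φₑ k) * K L r j) m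
        ≈⟨ *-congˡ (E*K L m r m≤L) ⟩
      φₑ r * (sgn m * q ^ (r ℕ.* m) * φₑ m)
        ≈⟨ solve 4 (λ e s p f → e :* (s :* p :* f) := s :* (e :* f :* p)) ≈-refl _ _ _ _ ⟩
      sgn m * (φₑ r * φₑ m * q ^ (r ℕ.* m))
        ≈⟨ *-congˡ (φₑ-*-φₑ r m) ⟩
      sgn m * ((inv! r * inv! m) * q ^ ((r ℕ.+ m) C 2))
        ≈⟨ *-assoc _ _ _ ⟨
      sgn m * (inv! r * inv! m) * q ^ ((r ℕ.+ m) C 2)
        ≈⟨ *-congʳ (≈-sym (signedBinomial*inv! r m)) ⟩
      ι (signedBinomial r m) * inv! (r ℕ.+ m) * q ^ ((r ℕ.+ m) C 2)
        ≈⟨ *-assoc _ _ _ ⟩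
      ι (signedBinomial r m) * φₑ (r ℕ.+ m) ∎

    -- From the recursion to sums over sequences and compositions.

    -- the part of J coming from sequences with exactly k nonzero entries, in positions 1..k
    Jₖ : ℕ → ℕ → ℕ → Carrier
    Jₖ zero    r m       = δ m
    Jₖ (suc k) r zero    = 0#
    Jₖ (suc k) r (suc m) = ∑ (λ u v → weight r (suc u) * Jₖ k (suc u) v) m

    -- The sequences that survive in J are compositions with at most L parts, padded by zeros; the
    -- left side sorts them by the number k of parts.
    ∑<Jₖ : ∀ L r m → ∑< (λ k → Jₖ k r m) (suc L) ≈ J L r m
    ∑<Jₖ zero    r m       = +-identityʳ _
    ∑<Jₖ (suc L) r zero    = begin
      1# + ∑< (λ k → 0#) (suc L)   ≈⟨ +-congˡ (∑<-zero (suc L) (λ _ → ≈-refl)) ⟩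
      1# + 0#                      ≈⟨ +-identityʳ 1# ⟩
      1#                           ≈⟨ ≈-trans (*-cong (weight-zero r) (J-zero L 0)) (*-identityˡ _) ⟨
      weight r 0 * J L 0 0         ∎
    -- The summand k = 0 on the left and the summand with first entry 0 on the right are both zero.
    ∑<Jₖ (suc L) r (suc m) = +-cong (≈-sym (≈-trans (*-congˡ (J-zero L (suc m))) (zeroʳ _))) (begin
      ∑< (λ k → ∑ (λ u v → weight r (suc u) * Jₖ k (suc u) v) m) (suc L)
        ≈⟨ ∑<-∑-swap (λ k u v → weight r (suc u) * Jₖ k (suc u) v) m (suc L) ⟩
      ∑ (λ u v → ∑< (λ k → weight r (suc u) * Jₖ k (suc u) v) (suc L)) m
        ≈⟨ ∑-cong m (λ u v _ → ≈-trans (∑<-*ˡ _ (λ k → Jₖ k (suc u) v) (suc L)) (*-congˡ (∑<Jₖ L (suc u) v))) ⟩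
      ∑ (λ u v → weight r (suc u) * J L (suc u) v) m ∎)

    -- The summands of (a) and (b) are written differently but obey the same rule for splitting off
    -- the first entry, so one argument serves both.
    module Sequences (W : ℕ → List ℕ → Carrier) (W-[] : ∀ r → W r [] ≈ 1#)
                     (W-∷ : ∀ r x u → W r (x ∷ u) ≈ weight r x * W x u) where

      W-∷-sum : ∀ r x p l → sumOver (W r ∘ (x ∷_)) p l ≈ weight r x * sumOver (W x) p l
      W-∷-sum r x p l = ≈-trans (sumOver-cong l (W-∷ r x) (λ _ → refl)) (sum-map-*ˡ (weight r x) (W x) (filterᵇ p l))

      -- The bound B on the entries stays fixed while the prescribed sum m shrinks along the
      -- recursion, hence m ≤ B instead of equality.
      sum-sequences : ∀ L B r m → m ℕ.≤ B → sumOver (W r) (hasSum m) (boxLists L B) ≈ J L r m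
      sum-sequences zero    B r zero    m≤B = ≈-trans (+-identityʳ _) (W-[] r)
      sum-sequences zero    B r (suc m) m≤B = ≈-refl
      sum-sequences (suc L) B r m       m≤B = ≈-trans (sumOver-boxLists-suc (W r) (hasSum m) L B) (∑<-antidiagonal m≤B eq none)
        where
        eq : ∀ x v → x ℕ.+ v ≡ m → sumOver (W r ∘ (x ∷_)) (hasSum m ∘ (x ∷_)) (boxLists L B) ≈ weight r x * J L x v
        eq x v refl = begin
          sumOver (W r ∘ (x ∷_)) (hasSum m ∘ (x ∷_)) (boxLists L B)
            ≈⟨ sumOver-cong (boxLists L B) (λ _ → ≈-refl) (λ u → ≡ᵇ-+ˡ x (sumℕ u) v) ⟩
          sumOver (W r ∘ (x ∷_)) (hasSum v) (boxLists L B)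
            ≈⟨ W-∷-sum r x (hasSum v) (boxLists L B) ⟩
          weight r x * sumOver (W x) (hasSum v) (boxLists L B)
            ≈⟨ *-congˡ (sum-sequences L B x v (ℕ.≤-trans (ℕ.m≤n+m v x) m≤B)) ⟩
          weight r x * J L x v ∎
        none : ∀ x → m ℕ.< x → sumOver (W r ∘ (x ∷_)) (hasSum m ∘ (x ∷_)) (boxLists L B) ≈ 0#
        none x m<x = sumOver-none (boxLists L B) (λ u → <⇒+≢ᵇ m<x (sumℕ u))

      sum-positive : ∀ k B r m → m ℕ.≤ B → sumOver (W r) (isComposition m) (boxLists k B) ≈ Jₖ k r m
      sum-positive zero    B r zero    m≤B = ≈-trans (+-identityʳ _) (W-[] r)
      sum-positive zero    B r (suc m) m≤B = ≈-refl
      sum-positive (suc k) B r zero    m≤B = ≈-trans (sumOver-boxLists-suc (W r) (isComposition 0) k B)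
        (∑<-zero (suc B) none)
        where
        none : ∀ x → sumOver (W r ∘ (x ∷_)) (isComposition 0 ∘ (x ∷_)) (boxLists k B) ≈ 0#
        none zero    = sumOver-none (boxLists k B) (λ u → Bool.∧-zeroʳ (hasSum 0 u))
        none (suc x) = sumOver-none (boxLists k B) (λ _ → refl)
      sum-positive (suc k) (suc B) r (suc m) (s≤s m≤B) = begin
        sumOver (W r) (isComposition (suc m)) (boxLists (suc k) (suc B))
          ≈⟨ sumOver-boxLists-suc (W r) (isComposition (suc m)) k (suc B) ⟩
        f 0 + ∑< (λ x → f (suc x)) (suc B)
          ≈⟨ +-congʳ (sumOver-none (boxLists k (suc B)) (λ u → Bool.∧-zeroʳ (hasSum (suc m) u))) ⟩
        0# + ∑< (λ x → f (suc x)) (suc B)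
          ≈⟨ +-identityˡ _ ⟩
        ∑< (λ x → f (suc x)) (suc B)
          ≈⟨ ∑<-antidiagonal m≤B eq none ⟩
        ∑ (λ u v → weight r (suc u) * Jₖ k (suc u) v) m ∎
        where
        f : ℕ → Carrier
        f x = sumOver (W r ∘ (x ∷_)) (isComposition (suc m) ∘ (x ∷_)) (boxLists k (suc B))
        eq : ∀ x v → x ℕ.+ v ≡ m → f (suc x) ≈ weight r (suc x) * Jₖ k (suc x) v
        eq x v refl = begin
          f (suc x)
            ≈⟨ sumOver-cong (boxLists k (suc B)) (λ _ → ≈-refl) (λ u → cong (_∧ all positive u) (≡ᵇ-+ˡ x (sumℕ u) v)) ⟩
          sumOver (W r ∘ (suc x ∷_)) (isComposition v) (boxLists k (suc B))
            ≈⟨ W-∷-sum r (suc x) (isComposition v) (boxLists k (suc B)) ⟩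
          weight r (suc x) * sumOver (W (suc x)) (isComposition v) (boxLists k (suc B))
            ≈⟨ *-congˡ (sum-positive k (suc B) (suc x) v (ℕ.≤-trans (ℕ.m≤n+m v x) (ℕ.m≤n⇒m≤1+n m≤B))) ⟩
          weight r (suc x) * Jₖ k (suc x) v ∎
        none : ∀ x → m ℕ.< x → f (suc x) ≈ 0#
        none x m<x = sumOver-none (boxLists k (suc B)) (λ u → cong (_∧ all positive u) (<⇒+≢ᵇ m<x (sumℕ u)))

      sum-compositions : ∀ r m → sum (map (W r) (compositions (suc m))) ≈ J (suc m) r (suc m)
      sum-compositions r m = begin
        sum (map (W r) (concatMap f (map suc (upTo (suc m)))))
          ≈⟨ sum-map-concatMap (W r) f (map suc (upTo (suc m))) ⟩
        sum (map g (map suc (upTo (suc m))))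
          ≡⟨ cong (sum ∘ map g) (map-applyUpTo (λ x → x) suc (suc m)) ⟩
        sum (map g (applyUpTo suc (suc m)))
          ≡⟨ cong sum (map-applyUpTo suc g (suc m)) ⟩
        sum (applyUpTo (g ∘ suc) (suc m))
          ≡⟨ sum-applyUpTo (g ∘ suc) (suc m) ⟩
        ∑< (g ∘ suc) (suc m)
          ≈⟨ ∑<-cong (suc m) (λ k → sum-positive (suc k) (suc m) r (suc m) ℕ.≤-refl) ⟩
        ∑< (λ k → Jₖ (suc k) r (suc m)) (suc m)
          -- Compositions start at k = 1. The term k = 0 may be added because the empty sequence
          -- does not have the positive sum m + 1.
          ≈⟨ +-identityˡ _ ⟨
        ∑< (λ k → Jₖ k r (suc m)) (suc (suc m))
          ≈⟨ ∑<Jₖ (suc m) r (suc m) ⟩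
        J (suc m) r (suc m) ∎
        where
        f : ℕ → List (List ℕ)
        f k = filterᵇ (isComposition (suc m)) (boxLists k (suc m))
        g : ℕ → Carrier
        g k = sum (map (W r) (f k))

    -- Evaluation of e-expansions under φ.

    prod : List Carrier → Carrier
    prod = foldr _*_ 1#

    ev : EExpr → Carrier
    ev []            = 0#
    ev ((c , μ) ∷ E) = ι c * prod (map φₑ μ) + ev E

    ev-++ : ∀ E E′ → ev (E ++ E′) ≈ ev E + ev E′
    ev-++ []            E′ = ≈-sym (+-identityˡ _)
    ev-++ ((c , μ) ∷ E) E′ = ≈-trans (+-congˡ (ev-++ E E′)) (≈-sym (+-assoc _ _ _))

    ev-mulTerm : ∀ c k E → ev (mulTerm c k E) ≈ ι c * (φₑ k * ev E)
    ev-mulTerm c k []            = ≈-sym (≈-trans (*-congˡ (zeroʳ _)) (zeroʳ _))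
    ev-mulTerm c k ((d , μ) ∷ E) = ≈-trans (+-cong (*-congʳ (ι-* c d)) (ev-mulTerm c k E))
      (solve 5 (λ c d e p v → (c :* d) :* (e :* p) :+ c :* (e :* v) := c :* (e :* (d :* p :+ v))) ≈-refl
        (ι c) (ι d) (φₑ k) (prod (map φₑ μ)) (ev E))

    ev-antidiagonalConcat : ∀ F n → ev (antidiagonalConcat F n) ≈ ∑ (λ k j → ev (F k j)) n
    ev-antidiagonalConcat F zero    = ≈-refl
    ev-antidiagonalConcat F (suc n) =
      ≈-trans (ev-++ (F 0 (suc n)) _) (+-congˡ (ev-antidiagonalConcat (λ k → F (suc k)) n))

    ι-sign : ∀ k → ι (sign k) ≈ sgn k
    ι-sign zero    = ι-1
    ι-sign (suc k) = ≈-trans (ι-neg _) (≈-trans (-‿cong (ι-sign k)) (≈-sym (-1*x≈-x _)))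

    -- Parallel to `lin-pExpr`, with `E*[φ-K]` in the place of `alternating-pCoeffℚ`.
    ev-pExpr : ∀ L′ L r m → m ℕ.< L′ → m ℕ.≤ L → ev (pExpr L′ r m) ≈ φₑ r * K L r m
    ev-pExpr (suc L′) L r zero    _          _     = begin
      ι (signedBinomial r 0) * (φₑ (r ℕ.+ 0) * 1#) + 0#     ≈⟨ ≈-trans (+-identityʳ _) (*-congˡ (*-identityʳ _)) ⟩
      ι (signedBinomial r 0) * φₑ (r ℕ.+ 0)                 ≈⟨ E*[φ-K] L r 0 z≤n ⟨
      (1# * φₑ 0) * (φₑ r * K L r 0)                        ≈⟨ *-congʳ (≈-trans (*-identityˡ _) φₑ-zero) ⟩
      1# * (φₑ r * K L r 0)                                 ≈⟨ *-identityˡ _ ⟩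
      φₑ r * K L r 0                                        ∎
    ev-pExpr (suc L′) L r (suc m) (s≤s m<L′) m<L = begin
      ι s * (φₑ (r ℕ.+ suc m) * 1#) + ev (antidiagonalConcat (λ k j → mulTerm (sign k) (suc k) (pExpr L′ r j)) m)
        ≈⟨ +-cong (*-congˡ (*-identityʳ _)) (≈-trans (ev-antidiagonalConcat _ m) (∑-cong m term)) ⟩
      ι s * φₑ (r ℕ.+ suc m) + S
        ≈⟨ +-congʳ (E*[φ-K] L r (suc m) m<L) ⟨
      (1# * φₑ 0) * X (suc m) + ∑ (λ k j → ((- 1# * sgn k) * φₑ (suc k)) * X j) m + S
        ≈⟨ +-congʳ (+-cong (≈-trans (*-congʳ (≈-trans (*-identityˡ _) φₑ-zero)) (*-identityˡ _))
                           (≈-trans (∑-cong m (λ k j _ → rearrange _ _ _ _)) (∑-*ˡ (- 1#) _ m))) ⟩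
      X (suc m) + - 1# * S + S
        ≈⟨ +-assoc _ _ _ ⟩
      X (suc m) + (- 1# * S + S)
        ≈⟨ +-congˡ (≈-trans (+-congʳ (-1*x≈-x S)) (-‿inverseˡ S)) ⟩
      X (suc m) + 0#
        ≈⟨ +-identityʳ _ ⟩
      X (suc m) ∎
      where
      s = signedBinomial r (suc m)
      X : ℕ → Carrier
      X j = φₑ r * K L r j
      S = ∑ (λ k j → sgn k * (φₑ (suc k) * X j)) m
      rearrange : ∀ n g e x → ((n * g) * e) * x ≈ n * (g * (e * x))
      rearrange = solve 4 (λ n g e x → ((n :* g) :* e) :* x := n :* (g :* (e :* x))) ≈-refl
      term : ∀ k j → k ℕ.+ j ≡ m → ev (mulTerm (sign k) (suc k) (pExpr L′ r j)) ≈ sgn k * (φₑ (suc k) * X j)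
      term k j eq = ≈-trans (ev-mulTerm (sign k) (suc k) (pExpr L′ r j))
        (*-cong (ι-sign k) (*-congˡ (ev-pExpr L′ L r j (ℕ.≤-<-trans j≤m m<L′) (ℕ.≤-trans j≤m (ℕ.<⇒≤ m<L)))))
        where
        j≤m : j ℕ.≤ m
        j≤m = subst (j ℕ.≤_) eq (ℕ.m≤n+m j k)

    -- The prefactor in the definition of J falls apart: q^{C(r,2)}/r! is φ(e_r), (1-q)^m turns J
    -- into K, and 1/m! cancels the m! of the formulas.
    normalisation : ∀ L r m →
      ι (invFact r ℚ.* invFact m) * ((1# + - q) ^ m * q ^ (r C 2) * (ι (fromℕ (m !)) * J L r m)) ≈ φₑ r * K L r m
    normalisation L r m = begin
      ι (invFact r ℚ.* invFact m) * ((1# + - q) ^ m * q ^ (r C 2) * (nat (m !) * J L r m))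
        ≈⟨ *-congʳ (ι-* _ _) ⟩
      (inv! r * inv! m) * ((1# + - q) ^ m * q ^ (r C 2) * (nat (m !) * J L r m))
        ≈⟨ solve 6 (λ i i′ p p′ n x → (i :* i′) :* (p :* p′ :* (n :* x)) := (n :* i′) :* ((i :* p′) :* (p :* x))) ≈-refl
             (inv! r) (inv! m) ((1# + - q) ^ m) (q ^ (r C 2)) (nat (m !)) (J L r m) ⟩
      (nat (m !) * inv! m) * (φₑ r * K L r m)
        ≈⟨ *-congʳ (≈-trans (≈-sym (ι-* _ _)) (≈-trans (⟦⟧-cong (fromℕ!*invFact m)) ι-1)) ⟩
      1# * (φₑ r * K L r m)
        ≈⟨ *-identityˡ _ ⟩
      φₑ r * K L r m ∎

    chain : ℕ → List ℕ → Carrier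
    chain r []      = 1#
    chain r (x ∷ u) = qnum r ^ x * chain x u

    inverseFactorials : List ℕ → ℚ
    inverseFactorials u = foldr ℚ._*_ 1ℚ (map invFact u)

    weightA : ℕ → List ℕ → Carrier
    weightA r u = ι (inverseFactorials u) * (chain r u * q ^ nprime u)

    weightA-∷ : ∀ r x u → weightA r (x ∷ u) ≈ weight r x * weightA x u
    weightA-∷ r x u = ≈-trans (*-cong (ι-* _ _) (*-congˡ (^-homo-* q (x C 2) (nprime u))))
      (solve 6 (λ i i′ p c y z → (i :* i′) :* ((p :* c) :* (y :* z)) := (p :* (i :* y)) :* (i′ :* (c :* z))) ≈-refl
        (inv! x) (ι (inverseFactorials u)) (qnum r ^ x) (chain x u) (q ^ (x C 2)) (q ^ nprime u))

    module SequencesA = Sequences weightA (λ _ → ≈-trans (*-cong ι-1 (*-identityˡ _)) (*-identityˡ _)) weightA-∷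

    factors : List ℕ → Carrier
    factors []      = 1#
    factors (x ∷ u) = inv! x * qnum x ^ headOr0 u * factors u

    weightB : ℕ → List ℕ → Carrier
    weightB r u = qnum r ^ headOr0 u * q ^ nprime u * factors u

    weightB-∷ : ∀ r x u → weightB r (x ∷ u) ≈ weight r x * weightB x u
    weightB-∷ r x u = ≈-trans (*-congʳ (*-congˡ (^-homo-* q (x C 2) (nprime u))))
      (solve 6 (λ p y z i h f → (p :* (y :* z)) :* ((i :* h) :* f) := (p :* (i :* y)) :* ((h :* z) :* f)) ≈-refl
        (qnum r ^ x) (q ^ (x C 2)) (q ^ nprime u) (inv! x) (qnum x ^ headOr0 u) (factors u))

    module SequencesB = Sequences weightB (λ _ → ≈-trans (*-identityʳ _) (*-identityˡ _)) weightB-∷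

-- The commutative ring ℚ[q] of coefficient lists.

infix 4 _≋_

-- A record, unlike _≈ₚ_, lets both sides be inferred from the type.
record _≋_ (p p′ : Poly) : Set where
  constructor mk≋
  field coeff≡ : p ≈ₚ p′
open _≋_ public

≋-refl : ∀ {p} → p ≋ p
≋-refl = mk≋ (λ _ → refl)

≋-sym : ∀ {p p′} → p ≋ p′ → p′ ≋ p
≋-sym (mk≋ e) = mk≋ (λ i → ≡.sym (e i))

≋-trans : ∀ {p p′ p″} → p ≋ p′ → p′ ≋ p″ → p ≋ p″
≋-trans (mk≋ e) (mk≋ e′) = mk≋ (λ i → ≡.trans (e i) (e′ i))

≡⇒≋ : ∀ {p p′} → p ≡ p′ → p ≋ p′
≡⇒≋ refl = ≋-refl

polySetoid : Setoid 0ℓ 0ℓ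
polySetoid = record { _≈_ = _≋_ ; isEquivalence = record { refl = ≋-refl ; sym = ≋-sym ; trans = ≋-trans } }

∷-cong : ∀ {a b p p′} → a ≡ b → p ≋ p′ → (a ∷ p) ≋ (b ∷ p′)
∷-cong a≡b (mk≋ e) = mk≋ λ { zero → a≡b ; (suc i) → e i }

[0]≋[] : (0ℚ ∷ []) ≋ []
[0]≋[] = mk≋ λ { zero → refl ; (suc i) → refl }

coeff-⊕ : ∀ p p′ i → coeff (p ⊕ p′) i ≡ coeff p i ℚ.+ coeff p′ i
coeff-⊕ []      p′       i       = ≡.sym (ℚ.+-identityˡ _)
coeff-⊕ (a ∷ p) []       i       = ≡.sym (ℚ.+-identityʳ _)
coeff-⊕ (a ∷ p) (b ∷ p′) zero    = refl
coeff-⊕ (a ∷ p) (b ∷ p′) (suc i) = coeff-⊕ p p′ i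

coeff-scale : ∀ c p i → coeff (scale c p) i ≡ c ℚ.* coeff p i
coeff-scale c []      i       = ≡.sym (ℚ.*-zeroʳ c)
coeff-scale c (a ∷ p) zero    = refl
coeff-scale c (a ∷ p) (suc i) = coeff-scale c p i

⊕-cong : ∀ {p p′ r r′} → p ≋ p′ → r ≋ r′ → p ⊕ r ≋ p′ ⊕ r′
⊕-cong {p} {p′} {r} {r′} (mk≋ e) (mk≋ f) = mk≋ λ i →
  ≡.trans (coeff-⊕ p r i) (≡.trans (cong₂ ℚ._+_ (e i) (f i)) (≡.sym (coeff-⊕ p′ r′ i)))

⊕-congˡ : ∀ p {r r′} → r ≋ r′ → p ⊕ r ≋ p ⊕ r′
⊕-congˡ p = ⊕-cong (≋-refl {p})

⊕-congʳ : ∀ r {p p′} → p ≋ p′ → p ⊕ r ≋ p′ ⊕ r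
⊕-congʳ r e = ⊕-cong e (≋-refl {r})

⊕-comm : ∀ p r → p ⊕ r ≋ r ⊕ p
⊕-comm p r = mk≋ λ i → ≡.trans (coeff-⊕ p r i) (≡.trans (ℚ.+-comm (coeff p i) (coeff r i)) (≡.sym (coeff-⊕ r p i)))

⊕-assoc : ∀ p r s → (p ⊕ r) ⊕ s ≋ p ⊕ (r ⊕ s)
⊕-assoc p r s = mk≋ λ i → begin
  coeff ((p ⊕ r) ⊕ s) i                      ≡⟨ coeff-⊕ (p ⊕ r) s i ⟩
  coeff (p ⊕ r) i ℚ.+ coeff s i              ≡⟨ cong (ℚ._+ coeff s i) (coeff-⊕ p r i) ⟩
  coeff p i ℚ.+ coeff r i ℚ.+ coeff s i      ≡⟨ ℚ.+-assoc (coeff p i) (coeff r i) (coeff s i) ⟩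
  coeff p i ℚ.+ (coeff r i ℚ.+ coeff s i)    ≡⟨ cong (coeff p i ℚ.+_) (coeff-⊕ r s i) ⟨
  coeff p i ℚ.+ coeff (r ⊕ s) i              ≡⟨ coeff-⊕ p (r ⊕ s) i ⟨
  coeff (p ⊕ (r ⊕ s)) i                      ∎
  where open ≡.≡-Reasoning

⊕-identityʳ : ∀ p → p ⊕ [] ≋ p
⊕-identityʳ []      = ≋-refl
⊕-identityʳ (a ∷ p) = ≋-refl

neg : Poly → Poly
neg = map (λ a → ℚ.- a)

neg-cong : ∀ {p p′} → p ≋ p′ → neg p ≋ neg p′
neg-cong {p} {p′} (mk≋ e) = mk≋ λ i → ≡.trans (coeff-neg p i) (≡.trans (cong (λ a → ℚ.- a) (e i)) (≡.sym (coeff-neg p′ i)))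
  where
  coeff-neg : ∀ p i → coeff (neg p) i ≡ ℚ.- coeff p i
  coeff-neg []      i       = refl
  coeff-neg (a ∷ p) zero    = refl
  coeff-neg (a ∷ p) (suc i) = coeff-neg p i

neg-inverseˡ : ∀ p → neg p ⊕ p ≋ []
neg-inverseˡ []      = ≋-refl
neg-inverseˡ (a ∷ p) = ≋-trans (∷-cong (ℚ.+-inverseˡ a) (neg-inverseˡ p)) [0]≋[]

⊕-interchange : ∀ p r s t → (p ⊕ r) ⊕ (s ⊕ t) ≋ (p ⊕ s) ⊕ (r ⊕ t)
⊕-interchange p r s t = begin
  (p ⊕ r) ⊕ (s ⊕ t)   ≈⟨ ⊕-assoc p r (s ⊕ t) ⟩
  p ⊕ (r ⊕ (s ⊕ t))   ≈⟨ ⊕-congˡ p (⊕-assoc r s t) ⟨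
  p ⊕ ((r ⊕ s) ⊕ t)   ≈⟨ ⊕-congˡ p (⊕-congʳ t (⊕-comm r s)) ⟩
  p ⊕ ((s ⊕ r) ⊕ t)   ≈⟨ ⊕-congˡ p (⊕-assoc s r t) ⟩
  p ⊕ (s ⊕ (r ⊕ t))   ≈⟨ ⊕-assoc p s (r ⊕ t) ⟨
  (p ⊕ s) ⊕ (r ⊕ t)   ∎
  where open import Relation.Binary.Reasoning.Setoid polySetoid

scale-cong : ∀ {c d p p′} → c ≡ d → p ≋ p′ → scale c p ≋ scale d p′
scale-cong {c} {_} {p} {p′} refl (mk≋ e) = mk≋ λ i →
  ≡.trans (coeff-scale c p i) (≡.trans (cong (c ℚ.*_) (e i)) (≡.sym (coeff-scale c p′ i)))

scale-⊕ : ∀ c p r → scale c (p ⊕ r) ≋ scale c p ⊕ scale c r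
scale-⊕ c []      r       = ≋-refl
scale-⊕ c (a ∷ p) []      = ≋-refl
scale-⊕ c (a ∷ p) (b ∷ r) = ∷-cong (ℚ.*-distribˡ-+ c a b) (scale-⊕ c p r)

scale-scale : ∀ c d p → scale c (scale d p) ≋ scale (c ℚ.* d) p
scale-scale c d []      = ≋-refl
scale-scale c d (a ∷ p) = ∷-cong (≡.sym (ℚ.*-assoc c d a)) (scale-scale c d p)

scale-zero : ∀ p → scale 0ℚ p ≋ []
scale-zero []      = ≋-refl
scale-zero (a ∷ p) = ≋-trans (∷-cong (ℚ.*-zeroˡ a) (scale-zero p)) [0]≋[]

scale-one : ∀ p → scale 1ℚ p ≋ p
scale-one []      = ≋-refl
scale-one (a ∷ p) = ∷-cong (ℚ.*-identityˡ a) (scale-one p)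

⊗-congʳ : ∀ p {r s} → r ≋ s → p ⊗ r ≋ p ⊗ s
⊗-congʳ []      e = ≋-refl
⊗-congʳ (a ∷ p) e = ⊕-cong (scale-cong {a} refl e) (∷-cong refl (⊗-congʳ p e))

⊗-zeroʳ : ∀ p → p ⊗ [] ≋ []
⊗-zeroʳ []      = ≋-refl
⊗-zeroʳ (a ∷ p) = ≋-trans (∷-cong refl (⊗-zeroʳ p)) [0]≋[]

⊗-∷ʳ : ∀ p b r → p ⊗ (b ∷ r) ≋ scale b p ⊕ (0ℚ ∷ (p ⊗ r))
⊗-∷ʳ []      b r = ≋-sym [0]≋[]
⊗-∷ʳ (a ∷ p) b r = ∷-cong (cong (ℚ._+ 0ℚ) (ℚ.*-comm a b)) (begin
  scale a r ⊕ p ⊗ (b ∷ r)                         ≈⟨ ⊕-cong ≋-refl (⊗-∷ʳ p b r) ⟩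
  scale a r ⊕ (scale b p ⊕ (0ℚ ∷ (p ⊗ r)))        ≈⟨ ⊕-assoc (scale a r) (scale b p) _ ⟨
  (scale a r ⊕ scale b p) ⊕ (0ℚ ∷ (p ⊗ r))        ≈⟨ ⊕-cong (⊕-comm (scale a r) (scale b p)) ≋-refl ⟩
  (scale b p ⊕ scale a r) ⊕ (0ℚ ∷ (p ⊗ r))        ≈⟨ ⊕-assoc (scale b p) (scale a r) _ ⟩
  scale b p ⊕ (scale a r ⊕ (0ℚ ∷ (p ⊗ r)))        ∎)
  where open import Relation.Binary.Reasoning.Setoid polySetoid

⊗-comm : ∀ p r → p ⊗ r ≋ r ⊗ p
⊗-comm []      r = ≋-sym (⊗-zeroʳ r)
⊗-comm (a ∷ p) r = ≋-trans (⊕-cong ≋-refl (∷-cong refl (⊗-comm p r))) (≋-sym (⊗-∷ʳ r a p))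

⊗-cong : ∀ {p p′ r r′} → p ≋ p′ → r ≋ r′ → p ⊗ r ≋ p′ ⊗ r′
⊗-cong {p} {p′} {r} {r′} e f = begin
  p ⊗ r     ≈⟨ ⊗-congʳ p f ⟩
  p ⊗ r′    ≈⟨ ⊗-comm p r′ ⟩
  r′ ⊗ p    ≈⟨ ⊗-congʳ r′ e ⟩
  r′ ⊗ p′   ≈⟨ ⊗-comm r′ p′ ⟩
  p′ ⊗ r′   ∎
  where open import Relation.Binary.Reasoning.Setoid polySetoid

⊗-distribˡ : ∀ p r s → p ⊗ (r ⊕ s) ≋ p ⊗ r ⊕ p ⊗ s
⊗-distribˡ []      r s = ≋-refl
⊗-distribˡ (a ∷ p) r s = ≋-trans
  (⊕-cong (scale-⊕ a r s) (∷-cong (≡.sym (ℚ.+-identityʳ 0ℚ)) (⊗-distribˡ p r s)))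
  (⊕-interchange (scale a r) (scale a s) (0ℚ ∷ (p ⊗ r)) (0ℚ ∷ (p ⊗ s)))

⊗-distribʳ : ∀ s p r → (p ⊕ r) ⊗ s ≋ p ⊗ s ⊕ r ⊗ s
⊗-distribʳ s p r = begin
  (p ⊕ r) ⊗ s     ≈⟨ ⊗-comm (p ⊕ r) s ⟩
  s ⊗ (p ⊕ r)     ≈⟨ ⊗-distribˡ s p r ⟩
  s ⊗ p ⊕ s ⊗ r   ≈⟨ ⊕-cong (⊗-comm s p) (⊗-comm s r) ⟩
  p ⊗ s ⊕ r ⊗ s   ∎
  where open import Relation.Binary.Reasoning.Setoid polySetoid

scale-⊗ : ∀ c p r → scale c p ⊗ r ≋ scale c (p ⊗ r)
scale-⊗ c []      r = ≋-refl
scale-⊗ c (a ∷ p) r = ≋-trans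
  (⊕-cong (≋-sym (scale-scale c a r)) (∷-cong (≡.sym (ℚ.*-zeroʳ c)) (scale-⊗ c p r)))
  (≋-sym (scale-⊕ c (scale a r) (0ℚ ∷ (p ⊗ r))))

⊗-assoc : ∀ p r s → (p ⊗ r) ⊗ s ≋ p ⊗ (r ⊗ s)
⊗-assoc []      r s = ≋-refl
⊗-assoc (a ∷ p) r s = begin
  (scale a r ⊕ (0ℚ ∷ (p ⊗ r))) ⊗ s              ≈⟨ ⊗-distribʳ s (scale a r) (0ℚ ∷ (p ⊗ r)) ⟩
  scale a r ⊗ s ⊕ (0ℚ ∷ (p ⊗ r)) ⊗ s            ≈⟨ ⊕-cong (scale-⊗ a r s) (⊕-cong (scale-zero s) (∷-cong refl (⊗-assoc p r s))) ⟩
  scale a (r ⊗ s) ⊕ (0ℚ ∷ (p ⊗ (r ⊗ s)))        ∎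
  where open import Relation.Binary.Reasoning.Setoid polySetoid

ι : ℚ → Poly
ι c = c ∷ []

ι-⊗ : ∀ c p → ι c ⊗ p ≋ scale c p
ι-⊗ c p = ≋-trans (⊕-cong ≋-refl [0]≋[]) (⊕-identityʳ (scale c p))

polyRing : CommutativeRing 0ℓ 0ℓ
polyRing = record
  { Carrier = Poly ; _≈_ = _≋_ ; _+_ = _⊕_ ; _*_ = _⊗_ ; -_ = neg ; 0# = [] ; 1# = oneP
  ; isCommutativeRing = record
    { isRing = record
      { +-isAbelianGroup = record
        { isGroup = record
          { isMonoid = record
            { isSemigroup = record
              { isMagma = record { isEquivalence = Setoid.isEquivalence polySetoid ; ∙-cong = ⊕-cong }
              ; assoc = ⊕-assoc }
            ; identity = (λ _ → ≋-refl) , ⊕-identityʳ }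
          ; inverse = neg-inverseˡ , (λ p → ≋-trans (⊕-comm p (neg p)) (neg-inverseˡ p))
          ; ⁻¹-cong = neg-cong }
        ; comm = ⊕-comm }
      ; *-cong = ⊗-cong
      ; *-assoc = ⊗-assoc
      ; *-identity = ⊗-identityˡ , (λ p → ≋-trans (⊗-comm p oneP) (⊗-identityˡ p))
      ; distrib = ⊗-distribˡ , ⊗-distribʳ }
    ; *-comm = ⊗-comm } }
  where
  ⊗-identityˡ : ∀ p → oneP ⊗ p ≋ p
  ⊗-identityˡ p = ≋-trans (ι-⊗ 1ℚ p) (scale-one p)

qₚ : Poly
qₚ = 0ℚ ∷ 1ℚ ∷ []

qₚ-⊗ : ∀ p → qₚ ⊗ p ≋ 0ℚ ∷ p
qₚ-⊗ p = ≋-trans (⊕-congʳ (0ℚ ∷ (ι 1ℚ ⊗ p)) (scale-zero p)) (∷-cong refl (≋-trans (ι-⊗ 1ℚ p) (scale-one p)))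

ι-homo : RingMorphisms.IsRingHomomorphism ℚ.+-*-rawRing (CommutativeRing.rawRing polyRing) ι
ι-homo = record
  { isSemiringHomomorphism = record
    { isNearSemiringHomomorphism = record
      { +-isMonoidHomomorphism = record
        { isMagmaHomomorphism = record
          { isRelHomomorphism = record { cong = λ { refl → ≋-refl } }
          ; homo = λ _ _ → ≋-refl }
        ; ε-homo = [0]≋[] }
      ; *-homo = λ c d → ≋-sym (ι-⊗ c (ι d)) }
    ; 1#-homo = ≋-refl }
  ; -‿homo = λ _ → ≋-refl }

qint-suc : ∀ r → qint (suc r) ≋ oneP ⊕ qₚ ⊗ qint r
qint-suc r = ≋-sym (≋-trans (⊕-congˡ oneP (qₚ-⊗ (qint r))) (∷-cong (ℚ.+-identityʳ 1ℚ) ≋-refl))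

-- The formulas over ℚ[q].

open Deformation.Specialisation polyRing ι ι-homo qₚ qint ≋-refl qint-suc
open ListSum polyRing using (sum; sumOver; sum-map-cong; sum-map-*ˡ)
open Exp (CommutativeRing.semiring polyRing) using (_^_)

powP≡^ : ∀ p k → powP p k ≡ p ^ k
powP≡^ p zero    = refl
powP≡^ p (suc k) = cong (p ⊗_) (powP≡^ p k)

qpow≋^ : ∀ k → qpow k ≋ qₚ ^ k
qpow≋^ zero    = ≋-refl
qpow≋^ (suc k) = ≋-trans (∷-cong refl (qpow≋^ k)) (≋-sym (qₚ-⊗ (qₚ ^ k)))

scale≋ι-⊗ : ∀ c {p p′} → p ≋ p′ → scale c p ≋ ι c ⊗ p′
scale≋ι-⊗ c {p′ = p′} e = ≋-trans (scale-cong {c} refl e) (≋-sym (ι-⊗ c p′))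

φe≋φₑ : ∀ k → φe k ≋ φₑ k
φe≋φₑ k = scale≋ι-⊗ (invFact k) (qpow≋^ (k C 2))

prodφe≋prodφₑ : ∀ μ → prodP (map φe μ) ≋ prod (map φₑ μ)
prodφe≋prodφₑ []      = ≋-refl
prodφe≋prodφₑ (k ∷ μ) = ⊗-cong (φe≋φₑ k) (prodφe≋prodφₑ μ)

φ≋ev : ∀ E → φ E ≋ ev E
-- In `go`, `f` stands for the anonymous function inside `φ`, known through its values on pairs.
φ≋ev = go _ (λ _ _ → ≋-refl)
  where
  go : (f : ℚ × List ℕ → Poly) → (∀ c μ → f (c , μ) ≋ scale c (prodP (map φe μ))) → ∀ E → sumP (map f E) ≋ ev E
  go f f≋ []            = ≋-refl
  go f f≋ ((c , μ) ∷ E) = ⊕-cong (≋-trans (f≋ c μ) (scale≋ι-⊗ c (prodφe≋prodφₑ μ))) (go f f≋ E)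

coeff-ev : ∀ i E → coeff (ev E) i ≡ lin E (λ μ → coeff (prod (map φₑ μ)) i)
coeff-ev i []            = refl
coeff-ev i ((c , μ) ∷ E) = ≡.trans (coeff-⊕ (ι c ⊗ prod (map φₑ μ)) (ev E) i)
  (cong₂ ℚ._+_ (≡.trans (coeff≡ (ι-⊗ c (prod (map φₑ μ))) i) (coeff-scale c (prod (map φₑ μ)) i)) (coeff-ev i E))

-- Independence of the e_k is phrased for rational-valued functionals, so φ is treated one
-- coefficient of q at a time. This makes `lin-unique` applicable and φ well defined.
coeff-prod-invariant : ∀ i → Invariant (λ μ → coeff (prod (map φₑ μ)) i)
coeff-prod-invariant i = record
  { perm  = λ p → coeff≡ (prod-↭ p) i
  ; drop0 = λ μ → coeff≡ (drop μ) i }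
  where
  open CommutativeRing polyRing using (*-identityˡ)
  drop : ∀ μ → φₑ 0 ⊗ prod (map φₑ μ) ≋ prod (map φₑ μ)
  drop μ = ≋-trans (⊗-cong φₑ-zero (≋-refl {prod (map φₑ μ)})) (*-identityˡ (prod (map φₑ μ)))
  prod-↭ : ∀ {μ ν} → μ ↭ ν → prod (map φₑ μ) ≋ prod (map φₑ ν)
  prod-↭ Perm.refl          = ≋-refl
  prod-↭ (Perm.prep k p)    = ⊗-congʳ (φₑ k) (prod-↭ p)
  prod-↭ {μ = _ ∷ _ ∷ μ} {ν = _ ∷ _ ∷ ν} (Perm.swap k l p) = begin
    φₑ k ⊗ (φₑ l ⊗ prod (map φₑ μ))   ≈⟨ ⊗-assoc (φₑ k) (φₑ l) (prod (map φₑ μ)) ⟨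
    (φₑ k ⊗ φₑ l) ⊗ prod (map φₑ μ)   ≈⟨ ⊗-cong (⊗-comm (φₑ k) (φₑ l)) (prod-↭ p) ⟩
    (φₑ l ⊗ φₑ k) ⊗ prod (map φₑ ν)   ≈⟨ ⊗-assoc (φₑ l) (φₑ k) (prod (map φₑ ν)) ⟩
    φₑ l ⊗ (φₑ k ⊗ prod (map φₑ ν))   ∎
    where open import Relation.Binary.Reasoning.Setoid polySetoid
  prod-↭ (Perm.trans p p′)  = ≋-trans (prod-↭ p) (prod-↭ p′)

Represents⇒lin : ∀ {n r E} → Represents n r E → ∀ a → lin E (λ μ → eCoeffℚ μ a) ≡ fromℕ (pCoeff n r a)
Represents⇒lin {E = E} H a = ≡.trans (≡.sym (go _ (λ _ _ → refl) E)) (H a)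
  where
  go : (f : ℚ × List ℕ → ℚ) → (∀ c μ → f (c , μ) ≡ c ℚ.* eCoeffℚ μ a) → ∀ E →
       foldr ℚ._+_ 0ℚ (map f E) ≡ lin E (λ μ → eCoeffℚ μ a)
  go f f≡ []            = refl
  go f f≡ ((c , μ) ∷ E) = cong₂ ℚ._+_ (f≡ c μ) (go f f≡ E)

φ-p : ∀ r m L E → m ≤ L → Represents (r ℕ.+ m) r E → φ E ≋ φₑ r ⊗ K L r m
φ-p r m L E m≤L H = begin
  φ E                   ≈⟨ φ≋ev E ⟩
  ev E                  ≈⟨ mk≋ unique ⟩
  ev (pExpr (suc m) r m)  ≈⟨ ev-pExpr (suc m) L r m ℕ.≤-refl m≤L ⟩
  φₑ r ⊗ K L r m        ∎
  where
  open import Relation.Binary.Reasoning.Setoid polySetoid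
  unique : ev E ≈ₚ ev (pExpr (suc m) r m)
  unique i = ≡.trans (coeff-ev i E) (≡.trans
    (lin-unique E (pExpr (suc m) r m)
      (λ a → ≡.trans (Represents⇒lin {E = E} H a) (≡.sym (≡.trans (lin-pExpr (suc m) r m ℕ.≤-refl a) (pCoeffℚ-correct r m a))))
      (coeff-prod-invariant i))
    (≡.sym (coeff-ev i (pExpr (suc m) r m))))

JIs-J : ∀ n r L P → suc r ≤ n → n ∸ suc r ≤ L →
        P ≋ ι (fromℕ ((n ∸ suc r) !)) ⊗ J L (suc r) (n ∸ suc r) → JIs n (suc r) P
JIs-J n r L P r<n m≤L P≋ E H = coeff≡ (begin
  φ E
    ≈⟨ φ-p (suc r) m L E m≤L (subst (λ n → Represents n (suc r) E) (≡.sym (ℕ.m+[n∸m]≡n r<n)) H) ⟩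
  φₑ (suc r) ⊗ K L (suc r) m
    ≈⟨ normalisation L (suc r) m ⟨
  ι c ⊗ ((oneP ⊕ neg qₚ) ^ m ⊗ qₚ ^ (suc r C 2) ⊗ (ι (fromℕ (m !)) ⊗ J L (suc r) m))
    ≈⟨ scale≋ι-⊗ c (⊗-cong (⊗-cong (≡⇒≋ (powP≡^ oneMinusQ m)) (qpow≋^ (suc r C 2))) P≋) ⟨
  scale c (powP oneMinusQ m ⊗ qpow (suc r C 2) ⊗ P) ∎)
  where
  open import Relation.Binary.Reasoning.Setoid polySetoid
  m = n ∸ suc r
  c = invFact (suc r) ℚ.* invFact m

chainA≡chain : ∀ r u → chainA r u ≡ chain r u
chainA≡chain r []      = refl
chainA≡chain r (x ∷ u) = cong₂ _⊗_ (powP≡^ (qint r) x) (chainA≡chain x u)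

prodB≋factors : ∀ u → prodB u ≋ factors u
prodB≋factors []      = ≋-refl
prodB≋factors (x ∷ u) = ⊗-cong (scale≋ι-⊗ (invFact x) (≡⇒≋ (powP≡^ (qint x) (headOr0 u)))) (prodB≋factors u)

formulaA≋J : ∀ n r → r < n → formulaA n r ≋ ι (fromℕ ((n ∸ r) !)) ⊗ J (n ∸ r) r (n ∸ r)
formulaA≋J n r r<n with n ∸ r | ℕ.m<n⇒0<n∸m r<n
-- For n = r the sum in (a) has no terms although J_n^{(n)} = 1; the strict inequality r < n
-- excludes this case.
... | suc m | _ = begin
  sumP (map (λ u → scale (multinom (suc m) u) (chainA r u ⊗ qpow (nprime u))) (compositions (suc m)))
    ≈⟨ sum-map-cong (compositions (suc m)) term ⟩
  sum (map (λ u → ι c ⊗ weightA r u) (compositions (suc m)))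
    ≈⟨ sum-map-*ˡ (ι c) (weightA r) (compositions (suc m)) ⟩
  ι c ⊗ sum (map (weightA r) (compositions (suc m)))
    ≈⟨ ⊗-congʳ (ι c) (SequencesA.sum-compositions r m) ⟩
  ι c ⊗ J (suc m) r (suc m) ∎
  where
  open import Relation.Binary.Reasoning.Setoid polySetoid
  c = fromℕ (suc m !)
  term : ∀ u → scale (multinom (suc m) u) (chainA r u ⊗ qpow (nprime u)) ≋ ι c ⊗ weightA r u
  term u = ≋-trans (≋-sym (scale-scale c (inverseFactorials u) (chainA r u ⊗ qpow (nprime u))))
    (scale≋ι-⊗ c (scale≋ι-⊗ (inverseFactorials u) (⊗-cong (≡⇒≋ (chainA≡chain r u)) (qpow≋^ (nprime u)))))

formulaB≋J : ∀ n r L → formulaB n r L ≋ ι (fromℕ ((n ∸ r) !)) ⊗ J L r (n ∸ r)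
formulaB≋J n r L = scale≋ι-⊗ (fromℕ ((n ∸ r) !)) (≋-trans
  (sum-map-cong (filterᵇ (hasSum (n ∸ r)) (boxLists L (n ∸ r)))
    (λ u → ⊗-cong (⊗-cong (≡⇒≋ (powP≡^ (qint r) (headOr0 u))) (qpow≋^ (nprime u))) (prodB≋factors u)))
  (SequencesB.sum-sequences L (n ∸ r) r (n ∸ r) ℕ.≤-refl))

theorem8p2 : ((n r : ℕ) → 1 ≤ r → r < n → JIs n r (formulaA n r))
    × ((n r : ℕ) → r ≤ n → (L : ℕ) → n ∸ r ≤ L → JIs n r (formulaB n r L))
theorem8p2 = partA , partB
  where
  partA : (n r : ℕ) → 1 ≤ r → r < n → JIs n r (formulaA n r)
  partA n (suc r) _ r<n = JIs-J n r (n ∸ suc r) _ (ℕ.<⇒≤ r<n) ℕ.≤-refl (formulaA≋J n (suc r) r<n)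
  partB : (n r : ℕ) → r ≤ n → (L : ℕ) → n ∸ r ≤ L → JIs n r (formulaB n r L)
  partB n       (suc r) r≤n L m≤L = JIs-J n r L _ r≤n m≤L (formulaB≋J n (suc r) L)
  -- For r = 0 the definition prescribes δ directly, and `J-zero` yields it for every L.
  partB zero    zero    _   L _   = coeff≡ (≋-trans (formulaB≋J 0 0 L) (⊗-congʳ (ι 1ℚ) (J-zero L 0)))
  partB (suc n) zero    _   L _   = coeff≡ (≋-trans (formulaB≋J (suc n) 0 L)
    (≋-trans (⊗-congʳ (ι (fromℕ (suc n !))) (J-zero L (suc n))) (⊗-zeroʳ (ι (fromℕ (suc n !))))))
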